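{- Let $n=p+k$ be the number of vertices of the broom $\mathcal B_{k,p}$. If $p/k\to0$ as $n\to\infty$, then $B_2=O(k)$.
   Context: For $k\ge3$ and $p\ge2$, the broom $\mathcal B_{k,p}$ is obtained from the path $\mathcal P_k=(1,\dots,k)$ and a star with $p$ leaves by identifying vertex $k$ of the path with the star's center. $B_2$ denotes the number of Braess edges of $\mathcal B_{k,p}$ joining a vertex of $\mathcal P_k$ to a pendent vertex of the star part. For a connected graph $G$, $\kappa(G)$ is Kemeny's constant of the simple random walk on $G$: $\kappa(G)=\sum_{j\ne i}m_{ij}\pi_j$ ($m_{ij}$ mean first passage time, $\pi$ stationary distribution); a pair of nonadjacent vertices is a Braess edge if adding the edge between them strictly increases $\kappa$. -}

module Defs where

open import Data.Nat as ℕ using (ℕ; zero; suc; _∸_; _<ᵇ_; _≡ᵇ_)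
open import Data.Fin as Fin using (Fin; toℕ)
open import Data.Bool using (Bool; true; false; _∧_; _∨_; not)
open import Data.Integer using (+_)
open import Data.Rational using (ℚ; 0ℚ; 1ℚ; _+_; _*_; _<_; _/_)
open import Data.Product using (Σ; Σ-syntax; ∃; _×_)
open import Data.List using (List; length)
open import Data.List.Relation.Unary.All using (All)
open import Data.List.Relation.Unary.Unique.Propositional using (Unique)
open import Relation.Nullary.Decidable using (⌊_⌋)
open import Relation.Binary.PropositionalEquality using (_≡_; _≢_)

ℕ→ℚ : ℕ → ℚ
ℕ→ℚ m = (+ m) / 1

Adj : ℕ → Set
Adj n = Fin n → Fin n → Bool

Σᶠ : ∀ {n} → (Fin n → ℚ) → ℚ
Σᶠ {zero}  f = 0ℚ
Σᶠ {suc n} f = f Fin.zero + Σᶠ (λ i → f (Fin.suc i))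

𝟙 : Bool → ℚ
𝟙 true  = 1ℚ
𝟙 false = 0ℚ

_==_ : ∀ {n} → Fin n → Fin n → Bool
i == j = ⌊ i Fin.≟ j ⌋

deg : ∀ {n} → Adj n → Fin n → ℚ
deg G i = Σᶠ (λ j → 𝟙 (G i j))

-- sum of degrees (= 2|E|); the stationary distribution of the simple random
-- walk is π_j = deg j / degSum
degSum : ∀ {n} → Adj n → ℚ
degSum G = Σᶠ (deg G)

-- m is the matrix of mean first passage times of the simple random walk on G:
-- the first-step equations  m_ij = 1 + Σ_{l ≠ j} p_il m_lj  with p_il = [i~l]/deg i,
-- written multiplied through by deg i.
IsMFPT : ∀ {n} → Adj n → (Fin n → Fin n → ℚ) → Set
IsMFPT G m = ∀ i j →
  deg G i * m i j ≡ deg G i + Σᶠ (λ l → 𝟙 (G i l ∧ not (l == j)) * m l j)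

-- K is Kemeny's constant of G:  K = Σ_{j ≠ i} m_ij π_j  (for every i),
-- written multiplied through by degSum G.
IsKemeny : ∀ {n} → Adj n → ℚ → Set
IsKemeny {n} G K = Σ[ m ∈ (Fin n → Fin n → ℚ) ] (IsMFPT G m ×
  (∀ i → K * degSum G ≡ Σᶠ (λ j → 𝟙 (not (j == i)) * (m i j * deg G j))))

addEdge : ∀ {n} → Adj n → Fin n → Fin n → Adj n
addEdge G u v x y = G x y ∨ ((x == u ∧ y == v) ∨ (x == v ∧ y == u))

IsBraess : ∀ {n} → Adj n → Fin n → Fin n → Set
IsBraess G u v = (u ≢ v) × (G u v ≡ false) ×
  Σ[ K ∈ ℚ ] Σ[ K' ∈ ℚ ] (IsKemeny G K × IsKemeny (addEdge G u v) K' × K < K')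

-- the broom B_{k,p} on Fin (k + p): path vertices 0..k-1 (paper: 1..k),
-- vertex k-1 is the star centre, k..k+p-1 are the pendent vertices.
broom : (k p : ℕ) → Adj (k ℕ.+ p)
broom k p x y =
  ((a <ᵇ k) ∧ ((b <ᵇ k) ∧ ((suc a ≡ᵇ b) ∨ (suc b ≡ᵇ a))))
  ∨ (((a ≡ᵇ (k ∸ 1)) ∧ not (b <ᵇ k)) ∨ ((b ≡ᵇ (k ∸ 1)) ∧ not (a <ᵇ k)))
  where
  a = toℕ x
  b = toℕ y

Type2Braess : (k p : ℕ) → Fin (k ℕ.+ p) × Fin (k ℕ.+ p) → Set
Type2Braess k p (i Data.Product., l) =
  (toℕ i ℕ.< k) × (k ℕ.≤ toℕ l) × IsBraess (broom k p) i l

B₂≤ : (k p c : ℕ) → Set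
B₂≤ k p c = (xs : List (Fin (k ℕ.+ p) × Fin (k ℕ.+ p))) →
  Unique xs → All (Type2Braess k p) xs → length xs ℕ.≤ c

{-# OPTIONS --safe #-}
module Submission where

-- Kemeny's constant times the degree sum S is Σ_j deg j · m_{0j}, the mean hitting times from the
-- free end 0 of the path.  Along degree-2 vertices these times have second difference -2, so they can be
-- solved for exactly, both in the broom and in the unicyclic graph got by joining a path vertex x at
-- distance y from the centre to a pendent vertex.  With q = p - 1 and cycle length c = y + 2 this gives
--   3 c (κ⁺ S⁺ − κ S) = 6 c x² − 12 q x y² − (terms that are nonnegative once y ≥ 3).
-- Since S ≤ S⁺ and κ ≥ 0, a Braess edge makes the left side positive, hence y ≤ 2 or q y < x.  In either
-- case p y ≤ 2 k as soon as p ≤ k, and so at most 2 k pairs (path vertex, pendent vertex) are Braess edges.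

open import Defs
open import Data.Bool using (Bool; true; false; _∧_; _∨_; not)
open import Data.Bool.Properties using (∧-zeroʳ; ∧-identityʳ; ∨-identityʳ)
open import Data.Fin as Fin using (Fin; toℕ; fromℕ<)
open import Data.Fin.Properties using (toℕ-fromℕ<; toℕ<n; toℕ-injective; fromℕ<-injective; injective⇒≤)
import Data.Integer as ℤ using (+_)
import Data.Integer.Properties as ℤ
open import Data.List using (List; length; lookup)
open import Data.List.Membership.Propositional.Properties using (∈-lookup)
open import Data.List.Relation.Unary.All as All using (All)
open import Data.List.Relation.Unary.AllPairs using (_∷_)
open import Data.List.Relation.Unary.Unique.Propositional using (Unique)
open import Data.Nat as ℕ using (ℕ; zero; suc; _≤_; _<_; _+_; _*_; z≤n; s≤s; _≡ᵇ_; _<ᵇ_; _∸_)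
open import Data.Nat.Coprimality using (1-coprimeTo) renaming (sym to coprime-sym)
open import Data.Nat.DivMod using (_%_; [m+kn]%n≡m%n; m<n⇒m%n≡m)
import Data.Nat.Properties as ℕ
open import Data.Product using (_×_; ∃; ∃-syntax; _,_; proj₁; proj₂)
open import Data.Rational using (ℚ; 0ℚ; 1ℚ; -_; nonNegative; positive) renaming (_<_ to _<ℚ_; _≤_ to _≤ℚ_; _*_ to _*ℚ_; _+_ to _+ℚ_; _-_ to _-ℚ_)
import Data.Rational.Properties as ℚ
open import Data.Sum using (_⊎_; inj₁; inj₂; [_,_]′)
open import Function using (_∘_)
open import Relation.Nullary using (yes; no; contradiction)
open import Relation.Nullary.Decidable using (dec-true; dec-false; dec⇒maybe)
open import Relation.Binary.PropositionalEquality using (_≡_; _≢_; refl; sym; trans; cong; cong₂; subst; subst₂; module ≡-Reasoning)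
open import Tactic.RingSolver using (solve-∀)
open import Tactic.RingSolver.Core.AlmostCommutativeRing using (AlmostCommutativeRing; fromCommutativeRing)

open ≡-Reasoning

-- `IsKemeny` hands over some matrix that satisfies the first-step equations, so each hitting time
-- has to be deduced from those equations. It is exhibited as a consequence of a linear combination
-- of them, which turns every evaluation into one polynomial identity. The free end 0 serves as base
-- point because a walk from there cannot use the new edge before reaching x: targets before x
-- contribute equally in both graphs, and x itself differs only in degree. For later targets the
-- times have an electrical form: the time on the bare cycle, plus twice the number of edges hanging
-- at a cycle vertex times a Green function with denominator c. Multiplying by c keeps everything
-- polynomial. The final count avoids dividing 2 k by p: a pair at distance y with leaf number r is
-- sent to r + (y - 1) p, which lies below p y.

ℚ-ring : AlmostCommutativeRing _ _
ℚ-ring = fromCommutativeRing ℚ.+-*-commutativeRing (λ x → dec⇒maybe (0ℚ ℚ.≟ x))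

-- Unlike ℕ→ℚ this reduces on successors without computing gcds.
ι : ℕ → ℚ
ι zero    = 0ℚ
ι (suc n) = 1ℚ +ℚ ι n

0≤ι : ∀ n → 0ℚ ≤ℚ ι n
0≤ι zero    = ℚ.≤-refl
0≤ι (suc n) = ℚ.≤-trans (0≤ι n) (ℚ.≤-trans (ℚ.≤-reflexive (sym (ℚ.+-identityˡ (ι n)))) (ℚ.+-monoˡ-≤ (ι n) (ℚ.nonNegative⁻¹ 1ℚ)))

ι-+ : ∀ m n → ι (m + n) ≡ ι m +ℚ ι n
ι-+ zero    n = sym (ℚ.+-identityˡ (ι n))
ι-+ (suc m) n = trans (cong (1ℚ +ℚ_) (ι-+ m n)) (sym (ℚ.+-assoc 1ℚ (ι m) (ι n)))

ι-* : ∀ m n → ι (m * n) ≡ ι m *ℚ ι n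
ι-* zero    n = sym (ℚ.*-zeroˡ (ι n))
ι-* (suc m) n = trans (ι-+ n (m * n)) (trans (cong (ι n +ℚ_) (ι-* m n)) (distrib (ι m) (ι n)))
  where
  distrib : ∀ a b → b +ℚ a *ℚ b ≡ (1ℚ +ℚ a) *ℚ b
  distrib = solve-∀ ℚ-ring

ι-mono-≤ : ∀ {m n} → m ≤ n → ι m ≤ℚ ι n
ι-mono-≤ {n = n} z≤n = 0≤ι n
ι-mono-≤ (s≤s m≤n)   = ℚ.+-monoʳ-≤ 1ℚ (ι-mono-≤ m≤n)

-- Sums over initial segments of the naturals

Σ< : ℕ → (ℕ → ℚ) → ℚ
Σ< zero    f = 0ℚ
Σ< (suc n) f = f 0 +ℚ Σ< n (f ∘ suc)

Σ<-cong : ∀ n {f g : ℕ → ℚ} → (∀ a → a < n → f a ≡ g a) → Σ< n f ≡ Σ< n g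
Σ<-cong zero    f≗g = refl
Σ<-cong (suc n) f≗g = cong₂ _+ℚ_ (f≗g 0 (s≤s z≤n)) (Σ<-cong n λ a a<n → f≗g (suc a) (s≤s a<n))

Σ<-0 : ∀ n {f : ℕ → ℚ} → (∀ a → a < n → f a ≡ 0ℚ) → Σ< n f ≡ 0ℚ
Σ<-0 zero    f≗0 = refl
Σ<-0 (suc n) f≗0 = cong₂ _+ℚ_ (f≗0 0 (s≤s z≤n)) (Σ<-0 n λ a a<n → f≗0 (suc a) (s≤s a<n))

Σ<-+ : ∀ n (f g : ℕ → ℚ) → Σ< n (λ a → f a +ℚ g a) ≡ Σ< n f +ℚ Σ< n g
Σ<-+ zero    f g = refl
Σ<-+ (suc n) f g = trans (cong (f 0 +ℚ g 0 +ℚ_) (Σ<-+ n (f ∘ suc) (g ∘ suc))) (interchange (f 0) (g 0) _ _)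
  where
  interchange : ∀ a b c d → (a +ℚ b) +ℚ (c +ℚ d) ≡ (a +ℚ c) +ℚ (b +ℚ d)
  interchange = solve-∀ ℚ-ring

Σ<-minus : ∀ n (f g : ℕ → ℚ) → Σ< n (λ a → f a -ℚ g a) ≡ Σ< n f -ℚ Σ< n g
Σ<-minus zero    f g = refl
Σ<-minus (suc n) f g = trans (cong (f 0 -ℚ g 0 +ℚ_) (Σ<-minus n (f ∘ suc) (g ∘ suc))) (interchange (f 0) (g 0) _ _)
  where
  interchange : ∀ a b c d → (a -ℚ b) +ℚ (c -ℚ d) ≡ (a +ℚ c) -ℚ (b +ℚ d)
  interchange = solve-∀ ℚ-ring

Σ<-*ˡ : ∀ n c (f : ℕ → ℚ) → Σ< n (λ a → c *ℚ f a) ≡ c *ℚ Σ< n f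
Σ<-*ˡ zero    c f = sym (ℚ.*-zeroʳ c)
Σ<-*ˡ (suc n) c f = trans (cong (c *ℚ f 0 +ℚ_) (Σ<-*ˡ n c (f ∘ suc))) (sym (ℚ.*-distribˡ-+ c (f 0) _))

Σ<-++ : ∀ m n (f : ℕ → ℚ) → Σ< (m + n) f ≡ Σ< m f +ℚ Σ< n (λ a → f (m + a))
Σ<-++ zero    n f = sym (ℚ.+-identityˡ _)
Σ<-++ (suc m) n f = trans (cong (f 0 +ℚ_) (Σ<-++ m n (f ∘ suc))) (sym (ℚ.+-assoc (f 0) _ _))

Σ<-last : ∀ n (f : ℕ → ℚ) → Σ< (suc n) f ≡ Σ< n f +ℚ f n
Σ<-last zero    f = ℚ.+-comm (f 0) 0ℚ
Σ<-last (suc n) f = trans (cong (f 0 +ℚ_) (Σ<-last n (f ∘ suc))) (sym (ℚ.+-assoc (f 0) _ _))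

Σ<-telescope : ∀ n {f : ℕ → ℚ} (F : ℕ → ℚ) → F 0 ≡ 0ℚ → (∀ a → a < n → F (suc a) ≡ F a +ℚ f a) → Σ< n f ≡ F n
Σ<-telescope zero    F F0 F-step = sym F0
Σ<-telescope (suc n) {f} F F0 F-step = begin
  Σ< (suc n) f     ≡⟨ Σ<-last n f ⟩
  Σ< n f +ℚ f n    ≡⟨ cong (_+ℚ f n) (Σ<-telescope n F F0 λ a a<n → F-step a (ℕ.m<n⇒m<1+n a<n)) ⟩
  F n +ℚ f n       ≡⟨ F-step n ℕ.≤-refl ⟨
  F (suc n)        ∎

Σ<-const : ∀ n c → Σ< n (λ _ → c) ≡ ι n *ℚ c
Σ<-const zero    c = sym (ℚ.*-zeroˡ c)
Σ<-const (suc n) c = trans (cong (c +ℚ_) (Σ<-const n c)) (distrib (ι n) c)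
  where
  distrib : ∀ a c → c +ℚ a *ℚ c ≡ (1ℚ +ℚ a) *ℚ c
  distrib = solve-∀ ℚ-ring

-- Serves above all for sums over the pendent vertices, where by symmetry all but one carry the same
-- value.
Σ<-except : ∀ n r {f : ℕ → ℚ} {c} → r < suc n → (∀ a → a < suc n → a ≢ r → f a ≡ c) → Σ< (suc n) f ≡ ι n *ℚ c +ℚ f r
Σ<-except n zero {f} {c} r<n f≗c =
  trans (cong (f 0 +ℚ_) (trans (Σ<-cong n λ a a<n → f≗c (suc a) (s≤s a<n) λ ()) (Σ<-const n c))) (ℚ.+-comm (f 0) _)
Σ<-except zero (suc r) (s≤s ()) f≗c
Σ<-except (suc n) (suc r) {f} {c} (s≤s r<n) f≗c = begin
  f 0 +ℚ Σ< (suc n) (f ∘ suc)        ≡⟨ cong₂ _+ℚ_ (f≗c 0 (s≤s z≤n) λ ()) (Σ<-except n r r<n λ a a<n a≢r → f≗c (suc a) (s≤s a<n) (a≢r ∘ ℕ.suc-injective)) ⟩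
  c +ℚ (ι n *ℚ c +ℚ f (suc r))       ≡⟨ distrib (ι n) c (f (suc r)) ⟩
  ι (suc n) *ℚ c +ℚ f (suc r)        ∎
  where
  distrib : ∀ a c d → c +ℚ (a *ℚ c +ℚ d) ≡ (1ℚ +ℚ a) *ℚ c +ℚ d
  distrib = solve-∀ ℚ-ring

Σ<-mono-≤ : ∀ n {f g : ℕ → ℚ} → (∀ a → a < n → f a ≤ℚ g a) → Σ< n f ≤ℚ Σ< n g
Σ<-mono-≤ zero    f≤g = ℚ.≤-refl
Σ<-mono-≤ (suc n) f≤g = ℚ.+-mono-≤ (f≤g 0 (s≤s z≤n)) (Σ<-mono-≤ n λ a a<n → f≤g (suc a) (s≤s a<n))

Σ<-nonneg : ∀ n {f : ℕ → ℚ} → (∀ a → a < n → 0ℚ ≤ℚ f a) → 0ℚ ≤ℚ Σ< n f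
Σ<-nonneg n {f} 0≤f = ℚ.≤-trans (ℚ.≤-reflexive (sym (Σ<-0 n {λ _ → 0ℚ} λ _ _ → refl))) (Σ<-mono-≤ n 0≤f)

Σ<-pick : ∀ n r (f : ℕ → ℚ) → r < n → Σ< n (λ a → 𝟙 (a ≡ᵇ r) *ℚ f a) ≡ f r
Σ<-pick (suc n) r f r<n = begin
  Σ< (suc n) (λ a → 𝟙 (a ≡ᵇ r) *ℚ f a)     ≡⟨ Σ<-except n r r<n (λ a _ a≢r → trans (cong (λ b → 𝟙 b *ℚ f a) (dec-false (a ℕ.≟ r) a≢r)) (ℚ.*-zeroˡ (f a))) ⟩
  ι n *ℚ 0ℚ +ℚ 𝟙 (r ≡ᵇ r) *ℚ f r           ≡⟨ cong (λ b → ι n *ℚ 0ℚ +ℚ 𝟙 b *ℚ f r) (dec-true (r ℕ.≟ r) refl) ⟩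
  ι n *ℚ 0ℚ +ℚ 1ℚ *ℚ f r                   ≡⟨ cleanup (ι n) (f r) ⟩
  f r                                      ∎
  where
  cleanup : ∀ a b → a *ℚ 0ℚ +ℚ 1ℚ *ℚ b ≡ b
  cleanup = solve-∀ ℚ-ring

-- Passing from `Fin n` to natural-number vertices

Σᶠ-toℕ : ∀ n {F : Fin n → ℚ} (f : ℕ → ℚ) → (∀ i → F i ≡ f (toℕ i)) → Σᶠ F ≡ Σ< n f
Σᶠ-toℕ zero    f F≗f = refl
Σᶠ-toℕ (suc n) f F≗f = cong₂ _+ℚ_ (F≗f Fin.zero) (Σᶠ-toℕ n (f ∘ suc) (F≗f ∘ Fin.suc))

==⇒≡ᵇ : ∀ {n} (i j : Fin n) → (i == j) ≡ (toℕ i ≡ᵇ toℕ j)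
==⇒≡ᵇ i j with i Fin.≟ j
... | yes refl = sym (dec-true (toℕ i ℕ.≟ toℕ i) refl)
... | no  i≢j  = sym (dec-false (toℕ i ℕ.≟ toℕ j) (i≢j ∘ toℕ-injective))

≡ᵇ-sym : ∀ a b → (a ≡ᵇ b) ≡ (b ≡ᵇ a)
≡ᵇ-sym zero    zero    = refl
≡ᵇ-sym zero    (suc b) = refl
≡ᵇ-sym (suc a) zero    = refl
≡ᵇ-sym (suc a) (suc b) = ≡ᵇ-sym a b

𝟙-∧ : ∀ p q → 𝟙 (p ∧ q) ≡ 𝟙 p *ℚ 𝟙 q
𝟙-∧ false q = sym (ℚ.*-zeroˡ (𝟙 q))
𝟙-∧ true  q = sym (ℚ.*-identityˡ (𝟙 q))

0≤𝟙 : ∀ b → 0ℚ ≤ℚ 𝟙 b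
0≤𝟙 false = ℚ.≤-refl
0≤𝟙 true  = ℚ.nonNegative⁻¹ 1ℚ

-- Neighbour sums and hitting times

nbrSum : ℕ → (ℕ → ℕ → Bool) → (ℕ → ℚ) → ℕ → ℚ
nbrSum n g f a = Σ< n (λ b → 𝟙 (g a b) *ℚ f b)

-- As a neighbour sum of the constant 1, the degree comes from the same local formula as the sum in
-- the first-step equation. Hence one evaluation of `nbrSum` at a vertex, valid for every `f`,
-- yields the whole equation; see `hit-local`.
degree : ℕ → (ℕ → ℕ → Bool) → ℕ → ℚ
degree n g = nbrSum n g (λ _ → 1ℚ)

extend : ∀ {n} → (Fin n → ℚ) → ℕ → ℚ
extend {zero}  f a       = 0ℚ
extend {suc n} f zero    = f Fin.zero
extend {suc n} f (suc a) = extend (f ∘ Fin.suc) a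

extend-toℕ : ∀ {n} (f : Fin n → ℚ) i → extend f (toℕ i) ≡ f i
extend-toℕ f Fin.zero    = refl
extend-toℕ f (Fin.suc i) = extend-toℕ (f ∘ Fin.suc) i

-- hit j a is the expected time to reach j from a, with the value 0 (and not the
-- mean return time) at a = j.
record HittingTimes (n : ℕ) (g : ℕ → ℕ → Bool) (K : ℚ) : Set where
  field
    hit        : ℕ → ℕ → ℚ
    hit-target : ∀ j → hit j j ≡ 0ℚ
    hit-step   : ∀ a j → a < n → j < n → a ≢ j → degree n g a *ℚ hit j a ≡ degree n g a +ℚ nbrSum n g (hit j) a
    kemeny     : K *ℚ Σ< n (degree n g) ≡ Σ< n (λ j → hit j 0 *ℚ degree n g j)

  hit-local : ∀ {a j} (s : (ℕ → ℚ) → ℚ) → (∀ f → nbrSum n g f a ≡ s f) → a < n → j < n → a ≢ j →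
    s (λ _ → 1ℚ) *ℚ hit j a ≡ s (λ _ → 1ℚ) +ℚ s (hit j)
  hit-local {a} {j} s nbr a<n j<n a≢j = begin
    s (λ _ → 1ℚ) *ℚ hit j a                  ≡⟨ cong (_*ℚ hit j a) (nbr _) ⟨
    degree n g a *ℚ hit j a                  ≡⟨ hit-step a j a<n j<n a≢j ⟩
    degree n g a +ℚ nbrSum n g (hit j) a     ≡⟨ cong₂ _+ℚ_ (nbr _) (nbr _) ⟩
    s (λ _ → 1ℚ) +ℚ s (hit j)                ∎

-- The indicator in `hit` replaces the mean return times on the diagonal by 0, so the sum in
-- `IsMFPT`, which skips the target, becomes a full neighbour sum. The Kemeny identity is taken at
-- vertex 0.
hittingTimes : ∀ {n} {G : Adj (suc n)} {g} {K} → (∀ i j → G i j ≡ g (toℕ i) (toℕ j)) →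
  IsKemeny G K → HittingTimes (suc n) g K
hittingTimes {n} {G} {g} {K} G≗g (m , mfpt , kem) = record
  { hit        = hit
  ; hit-target = λ j → trans (cong (λ b → 𝟙 (not b) *ℚ M j j) (dec-true (j ℕ.≟ j) refl)) (ℚ.*-zeroˡ (M j j))
  ; hit-step   = step
  ; kemeny     = begin
      K *ℚ Σ< (suc n) (degree (suc n) g)   ≡⟨ cong (K *ℚ_) (Σᶠ-toℕ (suc n) (degree (suc n) g) deg-toℕ) ⟨
      K *ℚ degSum G                        ≡⟨ kem Fin.zero ⟩
      _                                    ≡⟨ Σᶠ-toℕ (suc n) (λ j → hit j 0 *ℚ degree (suc n) g j) summand ⟩
      _                                    ∎
  }
  where
  M : ℕ → ℕ → ℚ
  M a j = extend (λ i → extend (m i) j) a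

  M-toℕ : ∀ i j → M (toℕ i) (toℕ j) ≡ m i j
  M-toℕ i j = trans (extend-toℕ (λ i → extend (m i) (toℕ j)) i) (extend-toℕ (m i) j)

  hit : ℕ → ℕ → ℚ
  hit j a = 𝟙 (not (a ≡ᵇ j)) *ℚ M a j

  deg-toℕ : ∀ i → deg G i ≡ degree (suc n) g (toℕ i)
  deg-toℕ i = Σᶠ-toℕ (suc n) (λ b → 𝟙 (g (toℕ i) b) *ℚ 1ℚ) λ j → trans (cong 𝟙 (G≗g i j)) (sym (ℚ.*-identityʳ _))

  summand : ∀ j → 𝟙 (not (j == Fin.zero)) *ℚ (m Fin.zero j *ℚ deg G j) ≡ hit (toℕ j) 0 *ℚ degree (suc n) g (toℕ j)
  summand j = trans (sym (ℚ.*-assoc (𝟙 (not (j == Fin.zero))) (m Fin.zero j) (deg G j)))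
    (cong₂ _*ℚ_ (cong₂ _*ℚ_ (cong (𝟙 ∘ not) (trans (==⇒≡ᵇ j Fin.zero) (≡ᵇ-sym (toℕ j) 0))) (sym (M-toℕ Fin.zero j))) (deg-toℕ j))

  nbr-toℕ : ∀ i j → Σᶠ (λ l → 𝟙 (G i l ∧ not (l == j)) *ℚ m l j) ≡ nbrSum (suc n) g (hit (toℕ j)) (toℕ i)
  nbr-toℕ i j = Σᶠ-toℕ (suc n) (λ b → 𝟙 (g (toℕ i) b) *ℚ hit (toℕ j) b) λ l → begin
    𝟙 (G i l ∧ not (l == j)) *ℚ m l j                 ≡⟨ cong (_*ℚ m l j) (𝟙-∧ (G i l) _) ⟩
    𝟙 (G i l) *ℚ 𝟙 (not (l == j)) *ℚ m l j            ≡⟨ ℚ.*-assoc (𝟙 (G i l)) _ _ ⟩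
    𝟙 (G i l) *ℚ (𝟙 (not (l == j)) *ℚ m l j)          ≡⟨ cong₂ (λ p q → 𝟙 p *ℚ q) (G≗g i l) (cong₂ _*ℚ_ (cong (𝟙 ∘ not) (==⇒≡ᵇ l j)) (sym (M-toℕ l j))) ⟩
    𝟙 (g (toℕ i) (toℕ l)) *ℚ hit (toℕ j) (toℕ l)      ∎

  step′ : ∀ i j → toℕ i ≢ toℕ j → degree (suc n) g (toℕ i) *ℚ hit (toℕ j) (toℕ i) ≡ degree (suc n) g (toℕ i) +ℚ nbrSum (suc n) g (hit (toℕ j)) (toℕ i)
  step′ i j i≢j = begin
    degree (suc n) g (toℕ i) *ℚ hit (toℕ j) (toℕ i)   ≡⟨ cong₂ _*ℚ_ (sym (deg-toℕ i)) hit≡m ⟩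
    deg G i *ℚ m i j                                  ≡⟨ mfpt i j ⟩
    _                                                 ≡⟨ cong₂ _+ℚ_ (deg-toℕ i) (nbr-toℕ i j) ⟩
    _                                                 ∎
    where
    hit≡m : hit (toℕ j) (toℕ i) ≡ m i j
    hit≡m = trans (cong₂ _*ℚ_ (cong (𝟙 ∘ not) (dec-false (toℕ i ℕ.≟ toℕ j) i≢j)) (M-toℕ i j)) (ℚ.*-identityˡ (m i j))

  step : ∀ a j → a < suc n → j < suc n → a ≢ j → degree (suc n) g a *ℚ hit j a ≡ degree (suc n) g a +ℚ nbrSum (suc n) g (hit j) a
  step a j a<n j<n with step′ (fromℕ< a<n) (fromℕ< j<n)
  ... | eq rewrite toℕ-fromℕ< a<n | toℕ-fromℕ< j<n = eq

-- Neighbourhoods in the broom and after adding an edge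

broomᵇ : ℕ → ℕ → ℕ → Bool
broomᵇ k a b =
  ((a <ᵇ k) ∧ ((b <ᵇ k) ∧ ((suc a ≡ᵇ b) ∨ (suc b ≡ᵇ a))))
  ∨ (((a ≡ᵇ (k ∸ 1)) ∧ not (b <ᵇ k)) ∨ ((b ≡ᵇ (k ∸ 1)) ∧ not (a <ᵇ k)))

addEdgeᵇ : (ℕ → ℕ → Bool) → ℕ → ℕ → ℕ → ℕ → Bool
addEdgeᵇ g u v a b = g a b ∨ (((a ≡ᵇ u) ∧ (b ≡ᵇ v)) ∨ ((a ≡ᵇ v) ∧ (b ≡ᵇ u)))

addEdge-toℕ : ∀ {n} (G : Adj n) g → (∀ i j → G i j ≡ g (toℕ i) (toℕ j)) → ∀ u v i j →
  addEdge G u v i j ≡ addEdgeᵇ g (toℕ u) (toℕ v) (toℕ i) (toℕ j)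
addEdge-toℕ G g G≗g u v i j
  rewrite G≗g i j | ==⇒≡ᵇ i u | ==⇒≡ᵇ i v | ==⇒≡ᵇ j u | ==⇒≡ᵇ j v = refl

≡ᵇ-refl : ∀ a → (a ≡ᵇ a) ≡ true
≡ᵇ-refl a = dec-true (a ℕ.≟ a) refl

≢⇒≡ᵇ : ∀ {a b} → a ≢ b → (a ≡ᵇ b) ≡ false
≢⇒≡ᵇ {a} {b} = dec-false (a ℕ.≟ b)

<⇒<ᵇ : ∀ {a b} → a < b → (a <ᵇ b) ≡ true
<⇒<ᵇ {a} {b} = dec-true (a ℕ.<? b)

≥⇒<ᵇ : ∀ {a b} → b ≤ a → (a <ᵇ b) ≡ false
≥⇒<ᵇ {a} {b} b≤a = dec-false (a ℕ.<? b) (ℕ.≤⇒≯ b≤a)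

-- The edge is absent from `g` in both directions and is not a loop, so the alternatives in
-- `addEdgeᵇ` exclude each other and the indicator of the disjunction is the sum of their
-- indicators.
nbrSum-addEdge : ∀ n g {u v} → u < n → v < n → u ≢ v → g u v ≡ false → g v u ≡ false → ∀ f a →
  nbrSum n (addEdgeᵇ g u v) f a ≡ nbrSum n g f a +ℚ (𝟙 (a ≡ᵇ u) *ℚ f v +ℚ 𝟙 (a ≡ᵇ v) *ℚ f u)
nbrSum-addEdge n g {u} {v} u<n v<n u≢v guv gvu f a = begin
  nbrSum n (addEdgeᵇ g u v) f a
    ≡⟨ Σ<-cong n (λ b _ → pointwise b) ⟩
  Σ< n (λ b → 𝟙 (g a b) *ℚ f b +ℚ (𝟙 (a ≡ᵇ u) *ℚ (𝟙 (b ≡ᵇ v) *ℚ f b) +ℚ 𝟙 (a ≡ᵇ v) *ℚ (𝟙 (b ≡ᵇ u) *ℚ f b)))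
    ≡⟨ Σ<-+ n _ _ ⟩
  nbrSum n g f a +ℚ Σ< n (λ b → 𝟙 (a ≡ᵇ u) *ℚ (𝟙 (b ≡ᵇ v) *ℚ f b) +ℚ 𝟙 (a ≡ᵇ v) *ℚ (𝟙 (b ≡ᵇ u) *ℚ f b))
    ≡⟨ cong (nbrSum n g f a +ℚ_) (trans (Σ<-+ n _ _) (cong₂ _+ℚ_ (at u v v<n) (at v u u<n))) ⟩
  nbrSum n g f a +ℚ (𝟙 (a ≡ᵇ u) *ℚ f v +ℚ 𝟙 (a ≡ᵇ v) *ℚ f u) ∎
  where
  at : ∀ s t → t < n → Σ< n (λ b → 𝟙 (a ≡ᵇ s) *ℚ (𝟙 (b ≡ᵇ t) *ℚ f b)) ≡ 𝟙 (a ≡ᵇ s) *ℚ f t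
  at s t t<n = trans (Σ<-*ˡ n (𝟙 (a ≡ᵇ s)) _) (cong (𝟙 (a ≡ᵇ s) *ℚ_) (Σ<-pick n t f t<n))

  neither : ∀ z p q e → z *ℚ e ≡ z *ℚ e +ℚ (0ℚ *ℚ p +ℚ 0ℚ *ℚ q)
  neither = solve-∀ ℚ-ring

  missedˡ : ∀ z q e → z *ℚ e ≡ z *ℚ e +ℚ (1ℚ *ℚ (0ℚ *ℚ e) +ℚ 0ℚ *ℚ q)
  missedˡ = solve-∀ ℚ-ring

  missedʳ : ∀ z q e → z *ℚ e ≡ z *ℚ e +ℚ (0ℚ *ℚ q +ℚ 1ℚ *ℚ (0ℚ *ℚ e))
  missedʳ = solve-∀ ℚ-ring

  newˡ : ∀ q e → 1ℚ *ℚ e ≡ 0ℚ *ℚ e +ℚ (1ℚ *ℚ (1ℚ *ℚ e) +ℚ 0ℚ *ℚ q)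
  newˡ = solve-∀ ℚ-ring

  newʳ : ∀ q e → 1ℚ *ℚ e ≡ 0ℚ *ℚ e +ℚ (0ℚ *ℚ q +ℚ 1ℚ *ℚ (1ℚ *ℚ e))
  newʳ = solve-∀ ℚ-ring

  pointwise : ∀ b → 𝟙 (addEdgeᵇ g u v a b) *ℚ f b ≡
    𝟙 (g a b) *ℚ f b +ℚ (𝟙 (a ≡ᵇ u) *ℚ (𝟙 (b ≡ᵇ v) *ℚ f b) +ℚ 𝟙 (a ≡ᵇ v) *ℚ (𝟙 (b ≡ᵇ u) *ℚ f b))
  pointwise b with a ℕ.≟ u | a ℕ.≟ v
  ... | yes refl | yes refl = contradiction refl u≢v
  ... | no a≢u | no a≢v rewrite ≢⇒≡ᵇ a≢u | ≢⇒≡ᵇ a≢v | ∨-identityʳ (g a b) = neither (𝟙 (g a b)) (𝟙 (b ≡ᵇ v) *ℚ f b) (𝟙 (b ≡ᵇ u) *ℚ f b) (f b)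
  ... | yes refl | no a≢v rewrite ≡ᵇ-refl a | ≢⇒≡ᵇ a≢v with b ℕ.≟ v
  ...   | yes refl rewrite ≡ᵇ-refl b | guv = newˡ (𝟙 (b ≡ᵇ a) *ℚ f b) (f b)
  ...   | no b≢v rewrite ≢⇒≡ᵇ b≢v | ∨-identityʳ (g a b) = missedˡ (𝟙 (g a b)) (𝟙 (b ≡ᵇ a) *ℚ f b) (f b)
  pointwise b | no a≢u | yes refl rewrite ≡ᵇ-refl a | ≢⇒≡ᵇ a≢u with b ℕ.≟ u
  ...   | yes refl rewrite ≡ᵇ-refl b | gvu = newʳ (𝟙 (b ≡ᵇ a) *ℚ f b) (f b)
  ...   | no b≢u rewrite ≢⇒≡ᵇ b≢u | ∨-identityʳ (g a b) = missedʳ (𝟙 (g a b)) (𝟙 (b ≡ᵇ a) *ℚ f b) (f b)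

𝟙-pathNbr : ∀ a b → 𝟙 ((suc (suc a) ≡ᵇ b) ∨ (b ≡ᵇ a)) ≡ 𝟙 (b ≡ᵇ a) +ℚ 𝟙 (b ≡ᵇ suc (suc a))
𝟙-pathNbr zero    zero                = refl
𝟙-pathNbr zero    (suc zero)          = refl
𝟙-pathNbr zero    (suc (suc zero))    = refl
𝟙-pathNbr zero    (suc (suc (suc b))) = refl
𝟙-pathNbr (suc a) zero                = refl
𝟙-pathNbr (suc a) (suc b)             = 𝟙-pathNbr a b

-- The centre is the vertex `K`, one less than the number `k` of path vertices; the pendent vertices
-- are `k + r`.
module BroomNbr (K p : ℕ) where
  private
    k = suc K

  N : (ℕ → ℚ) → ℕ → ℚ
  N = nbrSum (k + p) (broomᵇ k)

  broomᵇ-path : ∀ {a b} → a < k → b < k → broomᵇ k a b ≡ (suc a ≡ᵇ b) ∨ (suc b ≡ᵇ a)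
  broomᵇ-path {a} {b} a<k b<k
    rewrite <⇒<ᵇ a<k | <⇒<ᵇ b<k | ∧-zeroʳ (a ≡ᵇ K) | ∧-zeroʳ (b ≡ᵇ K) = ∨-identityʳ _

  broomᵇ-path-leaf : ∀ {a} r → a < k → broomᵇ k a (k + r) ≡ (a ≡ᵇ K)
  broomᵇ-path-leaf {a} r a<k
    rewrite <⇒<ᵇ a<k | ≥⇒<ᵇ (ℕ.m≤m+n k r) | ∧-identityʳ (a ≡ᵇ K) | ∧-zeroʳ (k + r ≡ᵇ K) = ∨-identityʳ _

  broomᵇ-leaf : ∀ r b → broomᵇ k (k + r) b ≡ (b ≡ᵇ K)
  broomᵇ-leaf r b
    rewrite ≥⇒<ᵇ (ℕ.m≤m+n k r) | ≢⇒≡ᵇ (ℕ.>⇒≢ (ℕ.m≤m+n k r)) = ∧-identityʳ _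

  private
    pathSum : (ℕ → ℚ) → ℕ → ℚ
    pathSum f a = Σ< k (λ b → 𝟙 ((suc a ≡ᵇ b) ∨ (suc b ≡ᵇ a)) *ℚ f b)

    N-split : ∀ f {a} → a < k → N f a ≡ pathSum f a +ℚ 𝟙 (a ≡ᵇ K) *ℚ Σ< p (λ r → f (k + r))
    N-split f {a} a<k = trans (Σ<-++ k p (λ b → 𝟙 (broomᵇ k a b) *ℚ f b)) (cong₂ _+ℚ_
      (Σ<-cong k λ b b<k → cong (λ e → 𝟙 e *ℚ f b) (broomᵇ-path a<k b<k))
      (trans (Σ<-cong p λ r _ → cong (λ e → 𝟙 e *ℚ f (k + r)) (broomᵇ-path-leaf r a<k)) (Σ<-*ˡ p (𝟙 (a ≡ᵇ K)) (λ r → f (k + r)))))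

    N-noncentre : ∀ f {a} → a < K → N f a ≡ pathSum f a
    N-noncentre f {a} a<K = trans (N-split f (ℕ.m<n⇒m<1+n a<K))
      (trans (cong (λ e → pathSum f a +ℚ 𝟙 e *ℚ Σ< p (λ r → f (k + r))) (≢⇒≡ᵇ (ℕ.<⇒≢ a<K))) (drop (pathSum f a) (Σ< p (λ r → f (k + r)))))
      where
      drop : ∀ s t → s +ℚ 0ℚ *ℚ t ≡ s
      drop = solve-∀ ℚ-ring

    pathSum-suc : ∀ f a → pathSum f (suc a) ≡ Σ< k (λ b → 𝟙 (b ≡ᵇ a) *ℚ f b) +ℚ Σ< k (λ b → 𝟙 (b ≡ᵇ suc (suc a)) *ℚ f b)
    pathSum-suc f a = trans (Σ<-cong k λ b _ → trans (cong (_*ℚ f b) (𝟙-pathNbr a b)) (ℚ.*-distribʳ-+ (f b) (𝟙 (b ≡ᵇ a)) (𝟙 (b ≡ᵇ suc (suc a))))) (Σ<-+ k (λ b → 𝟙 (b ≡ᵇ a) *ℚ f b) (λ b → 𝟙 (b ≡ᵇ suc (suc a)) *ℚ f b))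

  N-start : ∀ f → 0 < K → N f 0 ≡ f 1
  N-start f 0<K = trans (N-noncentre f 0<K) (trans (Σ<-cong k λ b _ → cong (λ e → 𝟙 e *ℚ f b) (eq b)) (Σ<-pick k 1 f (s≤s 0<K)))
    where
    eq : ∀ b → ((1 ≡ᵇ b) ∨ (suc b ≡ᵇ 0)) ≡ (b ≡ᵇ 1)
    eq b = trans (∨-identityʳ _) (≡ᵇ-sym 1 b)

  N-path : ∀ f a → suc a < K → N f (suc a) ≡ f a +ℚ f (suc (suc a))
  N-path f a a<K = trans (N-noncentre f a<K) (trans (pathSum-suc f a)
    (cong₂ _+ℚ_ (Σ<-pick k a f (ℕ.<-trans (ℕ.n<1+n a) (ℕ.m<n⇒m<1+n a<K))) (Σ<-pick k (suc (suc a)) f (s≤s a<K))))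

  N-centre : ∀ f a → suc a ≡ K → N f (suc a) ≡ f a +ℚ Σ< p (λ r → f (k + r))
  N-centre f a refl = trans (N-split f ℕ.≤-refl) (cong₂ _+ℚ_
    (trans (pathSum-suc f a) (trans (cong₂ _+ℚ_ (Σ<-pick k a f (ℕ.m<n⇒m<1+n ℕ.≤-refl))
      -- The would-be path successor of the centre has index `k`, outside the range of this sum.
      (Σ<-0 k λ b b<k → trans (cong (λ e → 𝟙 e *ℚ f b) (≢⇒≡ᵇ (ℕ.<⇒≢ b<k))) (ℚ.*-zeroˡ (f b)))) (ℚ.+-identityʳ (f a))))
    (trans (cong (λ e → 𝟙 e *ℚ Σ< p (λ r → f (k + r))) (≡ᵇ-refl K)) (ℚ.*-identityˡ _)))

  N-leaf : ∀ f r → N f (k + r) ≡ f K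
  N-leaf f r = trans (Σ<-cong (k + p) λ b _ → cong (λ e → 𝟙 e *ℚ f b) (broomᵇ-leaf r b)) (Σ<-pick (k + p) K f (ℕ.m≤m+n k p))

-- Solving first-step equations on paths and on the cycle

-≡0⇒≡ : ∀ {a b} → a -ℚ b ≡ 0ℚ → a ≡ b
-≡0⇒≡ {a} {b} a-b≡0 = trans (split a b) (trans (cong (_+ℚ b) a-b≡0) (ℚ.+-identityˡ b))
  where
  split : ∀ a b → a ≡ (a -ℚ b) +ℚ b
  split = solve-∀ ℚ-ring

infixl 4 _⊕_
infix 5 _⊛_

-- With `⊛` this writes an elimination: `c ⊛ e` is the multiple by `c` of the equation `e` brought
-- to one side, and `⊕` adds such multiples. The accompanying polynomial identity says that the
-- desired equation is their sum.
_⊕_ : ∀ {a b} → a ≡ 0ℚ → b ≡ 0ℚ → a +ℚ b ≡ 0ℚ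
refl ⊕ refl = refl

_⊛_ : ∀ c {a b} → a ≡ b → c *ℚ (a -ℚ b) ≡ 0ℚ
_⊛_ c {a} refl = trans (cong (c *ℚ_) (ℚ.+-inverseʳ a)) (ℚ.*-zeroʳ c)

-- Hitting times along a path of degree-2 vertices: consecutive differences grow by 2.
module Progression (F : ℕ → ℚ) (δ : ℚ) (t : ℕ) (start : F 0 ≡ δ +ℚ F 1)
  (step : ∀ a → suc a < t → ι 2 *ℚ F (suc a) ≡ ι 2 +ℚ (F a +ℚ F (suc (suc a)))) where

  difference : ∀ a → a < t → F a ≡ δ +ℚ ι 2 *ℚ ι a +ℚ F (suc a)
  difference zero    _    = trans start (eq δ (F 1))
    where
    eq : ∀ d f → d +ℚ f ≡ d +ℚ ι 2 *ℚ 0ℚ +ℚ f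
    eq = solve-∀ ℚ-ring
  difference (suc a) sa<t = -≡0⇒≡ (trans (eq δ (ι a) (F a) (F (suc a)) (F (suc (suc a))))
      (1ℚ ⊛ step a sa<t ⊕ 1ℚ ⊛ difference a (ℕ.<-trans (ℕ.n<1+n a) sa<t)))
    where
    eq : ∀ d i f₀ f₁ f₂ → f₁ -ℚ (d +ℚ ι 2 *ℚ (1ℚ +ℚ i) +ℚ f₂) ≡
      1ℚ *ℚ (ι 2 *ℚ f₁ -ℚ (ι 2 +ℚ (f₀ +ℚ f₂))) +ℚ 1ℚ *ℚ (f₀ -ℚ (d +ℚ ι 2 *ℚ i +ℚ f₁))
    eq = solve-∀ ℚ-ring

  total : ∀ a → a ≤ t → F 0 ≡ ι a *ℚ δ +ℚ ι a *ℚ (ι a -ℚ 1ℚ) +ℚ F a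
  total zero    _   = eq δ (F 0)
    where
    eq : ∀ d f → f ≡ 0ℚ *ℚ d +ℚ 0ℚ *ℚ (0ℚ -ℚ 1ℚ) +ℚ f
    eq = solve-∀ ℚ-ring
  total (suc a) a<t = trans (total a (ℕ.<⇒≤ a<t)) (trans (cong (ι a *ℚ δ +ℚ ι a *ℚ (ι a -ℚ 1ℚ) +ℚ_) (difference a a<t)) (eq δ (ι a) (F (suc a))))
    where
    eq : ∀ d i f → i *ℚ d +ℚ i *ℚ (i -ℚ 1ℚ) +ℚ (d +ℚ ι 2 *ℚ i +ℚ f) ≡
      (1ℚ +ℚ i) *ℚ d +ℚ (1ℚ +ℚ i) *ℚ ((1ℚ +ℚ i) -ℚ 1ℚ) +ℚ f
    eq = solve-∀ ℚ-ring

-- A, A₁, B, C, E are the hitting times from x, x + 1, the pendent vertex on the cycle, the centre and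
-- the path neighbour of the centre.  Each claim is a linear combination of the first-step equations;
-- the multipliers are those that eliminate all the other unknowns.
module CycleAlgebra (X : ℚ) {A A₁ B a : ℚ} (first : A ≡ a +ℚ A₁)
  (branch : ι 2 *ℚ A ≡ ι 2 *ℚ X +ℚ ι 2 +ℚ (A₁ +ℚ B)) where

  private
    solve-path : ∀ X A A₁ B C E a b q s t →
      (s +ℚ t +ℚ ι 2) *ℚ A -ℚ (s *ℚ (t +ℚ ι 2) *ℚ (ι 2 *ℚ X +ℚ (s +ℚ t +ℚ ι 2)) +ℚ ι 2 *ℚ q *ℚ s *ℚ t) ≡
        (s *ℚ (t +ℚ ι 2)) *ℚ (ι 2 *ℚ A -ℚ (ι 2 *ℚ X +ℚ ι 2 +ℚ (A₁ +ℚ B)))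
        +ℚ (- (s *ℚ (t +ℚ ι 2))) *ℚ (A -ℚ (a +ℚ A₁))
        +ℚ (s *ℚ (t +ℚ 1ℚ)) *ℚ (ι 2 *ℚ B -ℚ (ι 2 +ℚ (C +ℚ A)))
        +ℚ (s *ℚ t) *ℚ (ι 2 *ℚ C -ℚ (ι 2 +ℚ ι 2 *ℚ q +ℚ (E +ℚ B)))
        +ℚ (s *ℚ t) *ℚ (E -ℚ (b +ℚ ι 2 *ℚ (t -ℚ 1ℚ) +ℚ C))
        +ℚ (- s) *ℚ (0ℚ -ℚ (t *ℚ b +ℚ t *ℚ (t -ℚ 1ℚ) +ℚ C))
        +ℚ (t +ℚ ι 2) *ℚ (A -ℚ (s *ℚ a +ℚ s *ℚ (s -ℚ 1ℚ) +ℚ 0ℚ))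
    solve-path = solve-∀ ℚ-ring

  -- The target lies on the path, `s` steps after x and `t` before the centre; `b` is the first
  -- difference on the arc from target to centre. After division by the cycle length, the right side
  -- is the bare-cycle time s (t + 2), plus 2 X times the resistance between x and the target for
  -- the tail, plus 2 q times the Green function s t / c at the centre for the pendent edges.
  to-path : ∀ {q s t C E b} →
    ι 2 *ℚ B ≡ ι 2 +ℚ (C +ℚ A) → ι 2 *ℚ C ≡ ι 2 +ℚ ι 2 *ℚ q +ℚ (E +ℚ B) →
    E ≡ b +ℚ ι 2 *ℚ (t -ℚ 1ℚ) +ℚ C → 0ℚ ≡ t *ℚ b +ℚ t *ℚ (t -ℚ 1ℚ) +ℚ C →
    A ≡ s *ℚ a +ℚ s *ℚ (s -ℚ 1ℚ) +ℚ 0ℚ →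
    (s +ℚ t +ℚ ι 2) *ℚ A ≡ s *ℚ (t +ℚ ι 2) *ℚ (ι 2 *ℚ X +ℚ (s +ℚ t +ℚ ι 2)) +ℚ ι 2 *ℚ q *ℚ s *ℚ t
  to-path {q} {s} {t} {C} {E} {b} leaf centre arc-end arc₂ arc₁ = -≡0⇒≡ (trans (solve-path X A A₁ B C E a b q s t)
    (s *ℚ (t +ℚ ι 2) ⊛ branch ⊕ - (s *ℚ (t +ℚ ι 2)) ⊛ first ⊕ s *ℚ (t +ℚ 1ℚ) ⊛ leaf ⊕ s *ℚ t ⊛ centre
      ⊕ s *ℚ t ⊛ arc-end ⊕ - s ⊛ arc₂ ⊕ t +ℚ ι 2 ⊛ arc₁))

  private
    solve-centre : ∀ X A A₁ B C a y →
      (y +ℚ ι 2) *ℚ A -ℚ ((y +ℚ ι 2) *ℚ C +ℚ ι 2 *ℚ y *ℚ (ι 2 *ℚ X +ℚ (y +ℚ ι 2))) ≡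
        (ι 2 *ℚ y) *ℚ (ι 2 *ℚ A -ℚ (ι 2 *ℚ X +ℚ ι 2 +ℚ (A₁ +ℚ B)))
        +ℚ (- (ι 2 *ℚ y)) *ℚ (A -ℚ (a +ℚ A₁))
        +ℚ y *ℚ (ι 2 *ℚ B -ℚ (ι 2 +ℚ (C +ℚ A)))
        +ℚ ι 2 *ℚ (A -ℚ (y *ℚ a +ℚ y *ℚ (y -ℚ 1ℚ) +ℚ C))
    solve-centre = solve-∀ ℚ-ring

    solve-leaf : ∀ X A A₁ B C E a q y →
      (y +ℚ ι 2) *ℚ A -ℚ ((y +ℚ 1ℚ) *ℚ (ι 2 *ℚ X +ℚ (y +ℚ ι 2)) +ℚ ι 2 *ℚ q) ≡
        (y +ℚ 1ℚ) *ℚ (ι 2 *ℚ A -ℚ (ι 2 *ℚ X +ℚ ι 2 +ℚ (A₁ +ℚ B)))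
        +ℚ (- (y +ℚ 1ℚ)) *ℚ (A -ℚ (a +ℚ A₁))
        +ℚ 1ℚ *ℚ (ι 2 *ℚ C -ℚ (ι 2 +ℚ ι 2 *ℚ q +ℚ (E +ℚ B)))
        +ℚ 1ℚ *ℚ (E -ℚ (a +ℚ ι 2 *ℚ (y -ℚ 1ℚ) +ℚ C))
        +ℚ 1ℚ *ℚ (A -ℚ (y *ℚ a +ℚ y *ℚ (y -ℚ 1ℚ) +ℚ C))
        +ℚ (y +ℚ ι 2) *ℚ (B -ℚ 0ℚ)
    solve-leaf = solve-∀ ℚ-ring

    solve-pendent : ∀ X A A₁ B C E a q y →
      C -ℚ (ι 2 *ℚ q +ℚ ι 2 *ℚ y +ℚ ι 2 *ℚ X +ℚ ι 3) ≡
        1ℚ *ℚ (ι 3 *ℚ C -ℚ (ι 2 *ℚ q +ℚ 1ℚ +ℚ (E +ℚ B)))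
        +ℚ 1ℚ *ℚ (E -ℚ (a +ℚ ι 2 *ℚ (y -ℚ 1ℚ) +ℚ C))
        +ℚ 1ℚ *ℚ (ι 2 *ℚ B -ℚ (ι 2 +ℚ (C +ℚ A)))
        +ℚ 1ℚ *ℚ (ι 2 *ℚ A -ℚ (ι 2 *ℚ X +ℚ ι 2 +ℚ (A₁ +ℚ B)))
        +ℚ (- 1ℚ) *ℚ (A -ℚ (a +ℚ A₁))
    solve-pendent = solve-∀ ℚ-ring

  -- The two arcs from x to the centre have lengths y and 2. `C` is left free so that the formula
  -- serves the centre as target, with `C` zero, and also any pendent vertex off the cycle, which
  -- can only be reached through the centre.
  to-centre : ∀ {y C} →
    ι 2 *ℚ B ≡ ι 2 +ℚ (C +ℚ A) → A ≡ y *ℚ a +ℚ y *ℚ (y -ℚ 1ℚ) +ℚ C →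
    (y +ℚ ι 2) *ℚ A ≡ (y +ℚ ι 2) *ℚ C +ℚ ι 2 *ℚ y *ℚ (ι 2 *ℚ X +ℚ (y +ℚ ι 2))
  to-centre {y} {C} leaf arc = -≡0⇒≡ (trans (solve-centre X A A₁ B C a y)
    (ι 2 *ℚ y ⊛ branch ⊕ - (ι 2 *ℚ y) ⊛ first ⊕ y ⊛ leaf ⊕ ι 2 ⊛ arc))

  -- Here the arcs from x to the target have lengths y + 1 and 1, and the Green function at the
  -- centre is 1 / c.
  to-leaf : ∀ {q y C E} →
    ι 2 *ℚ C ≡ ι 2 +ℚ ι 2 *ℚ q +ℚ (E +ℚ B) → E ≡ a +ℚ ι 2 *ℚ (y -ℚ 1ℚ) +ℚ C →
    A ≡ y *ℚ a +ℚ y *ℚ (y -ℚ 1ℚ) +ℚ C → B ≡ 0ℚ →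
    (y +ℚ ι 2) *ℚ A ≡ (y +ℚ 1ℚ) *ℚ (ι 2 *ℚ X +ℚ (y +ℚ ι 2)) +ℚ ι 2 *ℚ q
  to-leaf {q} {y} {C} {E} centre arc-end arc B≡0 = -≡0⇒≡ (trans (solve-leaf X A A₁ B C E a q y)
    (y +ℚ 1ℚ ⊛ branch ⊕ - (y +ℚ 1ℚ) ⊛ first ⊕ 1ℚ ⊛ centre ⊕ 1ℚ ⊛ arc-end ⊕ 1ℚ ⊛ arc ⊕ y +ℚ ι 2 ⊛ B≡0))

  -- The pendent edge is a bridge with q + y + X + 1 edges behind it, and crossing a bridge takes on
  -- average one more than twice that number of steps.
  centre-to-pendent : ∀ {q y C E} →
    ι 3 *ℚ C ≡ ι 2 *ℚ q +ℚ 1ℚ +ℚ (E +ℚ B) → E ≡ a +ℚ ι 2 *ℚ (y -ℚ 1ℚ) +ℚ C →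
    ι 2 *ℚ B ≡ ι 2 +ℚ (C +ℚ A) → C ≡ ι 2 *ℚ q +ℚ ι 2 *ℚ y +ℚ ι 2 *ℚ X +ℚ ι 3
  centre-to-pendent {q} {y} {C} {E} centre arc-end leaf = -≡0⇒≡ (trans (solve-pendent X A A₁ B C E a q y)
    (1ℚ ⊛ centre ⊕ 1ℚ ⊛ arc-end ⊕ 1ℚ ⊛ leaf ⊕ 1ℚ ⊛ branch ⊕ - 1ℚ ⊛ first))

-- Hitting times from 0 in the broom

vertex≢leaf : ∀ {k a} r → a < k → a ≢ k + r
vertex≢leaf {k} r a<k = ℕ.<⇒≢ (ℕ.<-≤-trans a<k (ℕ.m≤m+n k r))

square : ∀ i {z} → z ≡ 0ℚ → i *ℚ 1ℚ +ℚ i *ℚ (i -ℚ 1ℚ) +ℚ z ≡ i *ℚ i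
square i refl = eq i
  where
  eq : ∀ i → i *ℚ 1ℚ +ℚ i *ℚ (i -ℚ 1ℚ) +ℚ 0ℚ ≡ i *ℚ i
  eq = solve-∀ ℚ-ring

module BroomTimes (K′ q : ℕ) {κ : ℚ} (H : HittingTimes (suc (suc K′) + suc q) (broomᵇ (suc (suc K′))) κ) where
  open HittingTimes H
  open BroomNbr (suc K′) (suc q)

  private
    K = suc K′
    k = suc K
    n = k + suc q

    <k⇒<n : ∀ {a} → a < k → a < n
    <k⇒<n a<k = ℕ.<-≤-trans a<k (ℕ.m≤m+n k (suc q))

    step-start : ∀ {j} → j < n → 0 ≢ j → hit j 0 ≡ 1ℚ +ℚ hit j 1
    step-start {j} j<n 0≢j = trans (sym (ℚ.*-identityˡ (hit j 0)))
      (hit-local (λ f → f 1) (λ f → N-start f (s≤s z≤n)) (s≤s z≤n) j<n 0≢j)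

    step-path : ∀ {j} a → j < n → suc a < K → suc a ≢ j → ι 2 *ℚ hit j (suc a) ≡ ι 2 +ℚ (hit j a +ℚ hit j (suc (suc a)))
    step-path a j<n a<K a≢j = hit-local (λ f → f a +ℚ f (suc (suc a))) (λ f → N-path f a a<K) (<k⇒<n (ℕ.m<n⇒m<1+n a<K)) j<n a≢j

  hit-path : ∀ j → j ≤ K → hit j 0 ≡ ι j *ℚ ι j
  hit-path zero    _   = hit-target 0
  hit-path (suc j) j≤K = trans (total (suc j) ℕ.≤-refl) (square (ι (suc j)) (hit-target (suc j)))
    where
    j<n : suc j < n
    j<n = <k⇒<n (s≤s j≤K)
    open Progression (hit (suc j)) 1ℚ (suc j) (step-start j<n λ ())
      (λ a a<j → step-path a j<n (ℕ.<-≤-trans a<j j≤K) (ℕ.<⇒≢ a<j))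

  -- K² steps lead to the centre; the other summand is the time to cross a bridge with K + q edges
  -- behind it.
  hit-leaf : ∀ r → r < suc q → hit (k + r) 0 ≡ ι K *ℚ ι K +ℚ (ι 2 *ℚ ι K +ℚ ι 2 *ℚ ι q +ℚ 1ℚ)
  hit-leaf r r<p = -≡0⇒≡ (trans (eq (F 0) (F K) (F K′) (ι K′) (ι q) (Σ< (suc q) (λ s → F (k + s))) (Σ< (suc q) (λ _ → 1ℚ)) (F (k + r)))
      -- The number of leaves enters the equation at the centre both alone and times `F K`; the
      -- multiplier `1 - F K` replaces it by 1 + q in both places.
      (1ℚ ⊛ total K ℕ.≤-refl ⊕ 1ℚ ⊛ difference K′ ℕ.≤-refl ⊕ 1ℚ ⊛ centre ⊕ 1ℚ -ℚ F K ⊛ Σ<-const (suc q) 1ℚ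
        ⊕ 1ℚ ⊛ Σ<-except q r r<p leaf ⊕ 1ℚ ⊛ hit-target (k + r)))
    where
    j<n : k + r < n
    j<n = ℕ.+-monoʳ-< k r<p

    F : ℕ → ℚ
    F = hit (k + r)

    open Progression F 1ℚ K (step-start j<n λ ())
      (λ a a<K → step-path a j<n a<K (vertex≢leaf r (ℕ.m<n⇒m<1+n a<K)))

    centre : (1ℚ +ℚ Σ< (suc q) (λ _ → 1ℚ)) *ℚ F K ≡ 1ℚ +ℚ Σ< (suc q) (λ _ → 1ℚ) +ℚ (F K′ +ℚ Σ< (suc q) (λ s → F (k + s)))
    centre = hit-local (λ f → f K′ +ℚ Σ< (suc q) (λ s → f (k + s))) (λ f → N-centre f K′ refl)
      (<k⇒<n ℕ.≤-refl) j<n (vertex≢leaf r ℕ.≤-refl)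

    leaf : ∀ s → s < suc q → s ≢ r → F (k + s) ≡ 1ℚ +ℚ F K
    leaf s s<p s≢r = trans (sym (ℚ.*-identityˡ (F (k + s))))
      (hit-local (λ f → f K) (λ f → N-leaf f s) (ℕ.+-monoʳ-< k s<p) j<n (s≢r ∘ ℕ.+-cancelˡ-≡ k s r))

    eq : ∀ F₀ C E i q S D T →
      F₀ -ℚ ((1ℚ +ℚ i) *ℚ (1ℚ +ℚ i) +ℚ (ι 2 *ℚ (1ℚ +ℚ i) +ℚ ι 2 *ℚ q +ℚ 1ℚ)) ≡
        1ℚ *ℚ (F₀ -ℚ ((1ℚ +ℚ i) *ℚ 1ℚ +ℚ (1ℚ +ℚ i) *ℚ ((1ℚ +ℚ i) -ℚ 1ℚ) +ℚ C))
        +ℚ 1ℚ *ℚ (E -ℚ (1ℚ +ℚ ι 2 *ℚ i +ℚ C))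
        +ℚ 1ℚ *ℚ ((1ℚ +ℚ D) *ℚ C -ℚ (1ℚ +ℚ D +ℚ (E +ℚ S)))
        +ℚ (1ℚ -ℚ C) *ℚ (D -ℚ (1ℚ +ℚ q) *ℚ 1ℚ)
        +ℚ 1ℚ *ℚ (S -ℚ (q *ℚ (1ℚ +ℚ C) +ℚ T))
        +ℚ 1ℚ *ℚ (T -ℚ 0ℚ)
    eq = solve-∀ ℚ-ring

-- Hitting times from 0 in the unicyclic graph

module CycleNbr (w x q r₀ : ℕ) (r₀<p : r₀ < suc q) where
  private
    -- `suc w` is the distance y from x to the centre. This form makes x < K automatic, so that x
    -- and `l` are not yet adjacent, and `w + x` is the path neighbour of the centre.
    K = suc w + x
    k = suc K
    n = k + suc q
    l = k + r₀

  open BroomNbr K (suc q)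

  g⁺ : ℕ → ℕ → Bool
  g⁺ = addEdgeᵇ (broomᵇ k) x l

  N⁺ : (ℕ → ℚ) → ℕ → ℚ
  N⁺ = nbrSum n g⁺

  x<K : x < K
  x<K = s≤s (ℕ.m≤n+m x w)

  <k⇒<n : ∀ {a} → a < k → a < n
  <k⇒<n a<k = ℕ.<-≤-trans a<k (ℕ.m≤m+n k (suc q))

  x<n : x < n
  x<n = <k⇒<n (ℕ.m<n⇒m<1+n x<K)

  leaf<n : ∀ {r} → r < suc q → k + r < n
  leaf<n = ℕ.+-monoʳ-< k

  x≢l : x ≢ l
  x≢l = vertex≢leaf r₀ (ℕ.m<n⇒m<1+n x<K)

  N⁺-split : ∀ f a → N⁺ f a ≡ N f a +ℚ (𝟙 (a ≡ᵇ x) *ℚ f l +ℚ 𝟙 (a ≡ᵇ l) *ℚ f x)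
  N⁺-split = nbrSum-addEdge n (broomᵇ k) x<n (leaf<n r₀<p) x≢l
    (trans (broomᵇ-path-leaf r₀ (ℕ.m<n⇒m<1+n x<K)) (≢⇒≡ᵇ (ℕ.<⇒≢ x<K)))
    (trans (broomᵇ-leaf r₀ x) (≢⇒≡ᵇ (ℕ.<⇒≢ x<K)))

  N⁺-other : ∀ f {a} → a ≢ x → a ≢ l → N⁺ f a ≡ N f a
  N⁺-other f {a} a≢x a≢l = trans (N⁺-split f a)
    (trans (cong₂ (λ b c → N f a +ℚ (𝟙 b *ℚ f l +ℚ 𝟙 c *ℚ f x)) (≢⇒≡ᵇ a≢x) (≢⇒≡ᵇ a≢l)) (eq (N f a) (f l) (f x)))
    where
    eq : ∀ s t u → s +ℚ (0ℚ *ℚ t +ℚ 0ℚ *ℚ u) ≡ s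
    eq = solve-∀ ℚ-ring

  N⁺-x : ∀ f → N⁺ f x ≡ N f x +ℚ f l
  N⁺-x f = trans (N⁺-split f x)
    (trans (cong₂ (λ b c → N f x +ℚ (𝟙 b *ℚ f l +ℚ 𝟙 c *ℚ f x)) (≡ᵇ-refl x) (≢⇒≡ᵇ x≢l)) (eq (N f x) (f l) (f x)))
    where
    eq : ∀ s t u → s +ℚ (1ℚ *ℚ t +ℚ 0ℚ *ℚ u) ≡ s +ℚ t
    eq = solve-∀ ℚ-ring

  N⁺-l : ∀ f → N⁺ f l ≡ f K +ℚ f x
  N⁺-l f = trans (N⁺-split f l)
    (trans (cong₂ (λ b c → N f l +ℚ (𝟙 b *ℚ f l +ℚ 𝟙 c *ℚ f x)) (≢⇒≡ᵇ (x≢l ∘ sym)) (≡ᵇ-refl l))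
      (trans (eq (N f l) (f l) (f x)) (cong (_+ℚ f x) (N-leaf f r₀))))
    where
    eq : ∀ s t u → s +ℚ (0ℚ *ℚ t +ℚ 1ℚ *ℚ u) ≡ s +ℚ u
    eq = solve-∀ ℚ-ring

  N⁺-start : ∀ f → 0 ≢ x → N⁺ f 0 ≡ f 1
  N⁺-start f 0≢x = trans (N⁺-other f 0≢x λ ()) (N-start f (s≤s z≤n))

  N⁺-path : ∀ f {a} → suc a < K → suc a ≢ x → N⁺ f (suc a) ≡ f a +ℚ f (suc (suc a))
  N⁺-path f {a} a<K a≢x = trans (N⁺-other f a≢x (vertex≢leaf r₀ (ℕ.m<n⇒m<1+n a<K))) (N-path f a a<K)

  N⁺-centre : ∀ f → N⁺ f K ≡ f (w + x) +ℚ Σ< (suc q) (λ r → f (k + r))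
  N⁺-centre f = trans (N⁺-other f (ℕ.>⇒≢ x<K) (vertex≢leaf r₀ ℕ.≤-refl)) (N-centre f (w + x) refl)

  N⁺-pendent : ∀ f {r} → r ≢ r₀ → N⁺ f (k + r) ≡ f K
  N⁺-pendent f {r} r≢r₀ = trans
    (N⁺-other f (vertex≢leaf r (ℕ.m<n⇒m<1+n x<K) ∘ sym) (r≢r₀ ∘ ℕ.+-cancelˡ-≡ k r r₀)) (N-leaf f r)

module CycleTimes (w x q r₀ : ℕ) (r₀<p : r₀ < suc q) {κ : ℚ}
  (H : HittingTimes (suc (suc w + x) + suc q) (addEdgeᵇ (broomᵇ (suc (suc w + x))) x (suc (suc w + x) + r₀)) κ) where
  open HittingTimes H
  open CycleNbr w x q r₀ r₀<p

  private
    K = suc w + x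
    k = suc K
    n = k + suc q
    l = k + r₀
    X = ι x
    Y = ι (suc w)
    Q = ι q
    c = Y +ℚ ι 2

    step-start : ∀ {j} → j < n → 0 ≢ j → 0 ≢ x → hit j 0 ≡ 1ℚ +ℚ hit j 1
    step-start {j} j<n 0≢j 0≢x = trans (sym (ℚ.*-identityˡ (hit j 0)))
      (hit-local (λ f → f 1) (λ f → N⁺-start f 0≢x) (s≤s z≤n) j<n 0≢j)

    step-path : ∀ {j} a → j < n → suc a < K → suc a ≢ j → suc a ≢ x →
      ι 2 *ℚ hit j (suc a) ≡ ι 2 +ℚ (hit j a +ℚ hit j (suc (suc a)))
    step-path a j<n a<K a≢j a≢x = hit-local (λ f → f a +ℚ f (suc (suc a))) (λ f → N⁺-path f a<K a≢x)
      (<k⇒<n (ℕ.m<n⇒m<1+n a<K)) j<n a≢j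

  -- All vertices before a target `j ≤ x` keep their neighbours, so the value is the one in the
  -- broom.
  hit-low : ∀ j → j ≤ x → hit j 0 ≡ ι j *ℚ ι j
  hit-low zero    _   = hit-target 0
  hit-low (suc j) j≤x = trans (total (suc j) ℕ.≤-refl) (square (ι (suc j)) (hit-target (suc j)))
    where
    j<n : suc j < n
    j<n = ℕ.≤-<-trans j≤x x<n
    open Progression (hit (suc j)) 1ℚ (suc j) (step-start j<n (λ ()) (ℕ.<⇒≢ (ℕ.<-≤-trans (s≤s z≤n) j≤x)))
      (λ a a<j → step-path a j<n (ℕ.<-trans (ℕ.<-≤-trans a<j j≤x) x<K) (ℕ.<⇒≢ a<j) (ℕ.<⇒≢ (ℕ.<-≤-trans a<j j≤x)))

  -- Targets beyond x: the walk from 0 must first reach x.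
  module Beyond (j : ℕ) (j<n : j < n) (x<j : x < j) where
    F : ℕ → ℚ
    F = hit j

    private
      δ : ℚ
      δ = F x -ℚ F (suc x)

      first : F x ≡ δ +ℚ F (suc x)
      first = eq (F x) (F (suc x))
        where
        eq : ∀ a b → a ≡ (a -ℚ b) +ℚ b
        eq = solve-∀ ℚ-ring

    -- Eliminates the tail between 0 and x. In the equation at x the tail survives only as the delay
    -- 2 X, twice its number of edges. For x = 0 there is no tail, and x has degree 2 instead of 3,
    -- hence the case split.
    approach : ∀ x′ → x ≡ x′ → F 0 ≡ X *ℚ X +ℚ F x × ι 2 *ℚ F x ≡ ι 2 *ℚ X +ℚ ι 2 +ℚ (F (suc x) +ℚ F l)
    approach zero refl = eq₁ (F 0) ,
      trans (hit-local (λ f → f 1 +ℚ f l) (λ f → trans (N⁺-x f) (cong (_+ℚ f l) (BroomNbr.N-start K (suc q) f (s≤s z≤n)))) x<n j<n (ℕ.<⇒≢ x<j))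
        (eq₂ (F 1 +ℚ F l))
      where
      eq₁ : ∀ a → a ≡ 0ℚ *ℚ 0ℚ +ℚ a
      eq₁ = solve-∀ ℚ-ring
      eq₂ : ∀ a → ι 2 +ℚ a ≡ ι 2 *ℚ 0ℚ +ℚ ι 2 +ℚ a
      eq₂ = solve-∀ ℚ-ring
    approach (suc x′) refl =
      trans (total x ℕ.≤-refl) (eq₁ X (F x)) ,
      -≡0⇒≡ (trans (eq₂ (ι x′) (F x′) (F x) (F (suc x)) (F l)) (1ℚ ⊛ branch ⊕ 1ℚ ⊛ difference x′ ℕ.≤-refl))
      where
      open Progression F 1ℚ x (step-start j<n (ℕ.<⇒≢ (ℕ.≤-<-trans z≤n x<j)) λ ())
        (λ a a<x → step-path a j<n (ℕ.<-trans a<x x<K) (ℕ.<⇒≢ (ℕ.<-trans a<x x<j)) (ℕ.<⇒≢ a<x))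
      branch : ι 3 *ℚ F x ≡ ι 3 +ℚ (F x′ +ℚ F (suc x) +ℚ F l)
      branch = hit-local (λ f → f x′ +ℚ f (suc x) +ℚ f l)
        (λ f → trans (N⁺-x f) (cong (_+ℚ f l) (BroomNbr.N-path K (suc q) f x′ x<K))) x<n j<n (ℕ.<⇒≢ x<j)
      eq₁ : ∀ i a → i *ℚ 1ℚ +ℚ i *ℚ (i -ℚ 1ℚ) +ℚ a ≡ i *ℚ i +ℚ a
      eq₁ = solve-∀ ℚ-ring
      eq₂ : ∀ i e a a₁ b → ι 2 *ℚ a -ℚ (ι 2 *ℚ (1ℚ +ℚ i) +ℚ ι 2 +ℚ (a₁ +ℚ b)) ≡
        1ℚ *ℚ (ι 3 *ℚ a -ℚ (ι 3 +ℚ (e +ℚ a₁ +ℚ b))) +ℚ 1ℚ *ℚ (e -ℚ (1ℚ +ℚ ι 2 *ℚ i +ℚ a))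
      eq₂ = solve-∀ ℚ-ring

    from-0 : ∀ {R} → c *ℚ F x ≡ R → c *ℚ F 0 ≡ c *ℚ (X *ℚ X) +ℚ R
    from-0 refl = trans (cong (c *ℚ_) (proj₁ (approach x refl))) (ℚ.*-distribˡ-+ c (X *ℚ X) (F x))

    open CycleAlgebra X {F x} {F (suc x)} {F l} {δ} first (proj₂ (approach x refl)) public

    module Arc (t : ℕ) (t≤y : t ≤ suc w) (t≤j : ∀ {a} → a < t → a + x ≢ j) =
      Progression (λ a → F (a + x)) δ t first
        (λ a a<t → step-path (a + x) j<n (ℕ.+-monoˡ-< x (ℕ.<-≤-trans a<t t≤y)) (t≤j a<t) (ℕ.>⇒≢ (s≤s (ℕ.m≤n+m x a))))

    leaf : j ≢ l → ι 2 *ℚ F l ≡ ι 2 +ℚ (F K +ℚ F x)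
    leaf j≢l = hit-local (λ f → f K +ℚ f x) N⁺-l (leaf<n r₀<p) j<n (j≢l ∘ sym)

    pendent : ∀ {r} → r < suc q → r ≢ r₀ → k + r ≢ j → F (k + r) ≡ 1ℚ +ℚ F K
    pendent {r} r<p r≢r₀ r≢j = trans (sym (ℚ.*-identityˡ (F (k + r))))
      (hit-local (λ f → f K) (λ f → N⁺-pendent f r≢r₀) (leaf<n r<p) j<n r≢j)

    centre′ : K ≢ j → (1ℚ +ℚ Σ< (suc q) (λ _ → 1ℚ)) *ℚ F K ≡ 1ℚ +ℚ Σ< (suc q) (λ _ → 1ℚ) +ℚ (F (w + x) +ℚ Σ< (suc q) (λ s → F (k + s)))
    centre′ K≢j = hit-local (λ f → f (w + x) +ℚ Σ< (suc q) (λ s → f (k + s))) N⁺-centre (<k⇒<n ℕ.≤-refl) j<n K≢j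

    -- Each of the q leaves off the cycle has value 1 + F K. Substituting this cancels q copies of
    -- `F K`, and those leaves remain only as the delay 2 Q.
    centre : K ≢ j → (∀ {r} → r ≢ r₀ → k + r ≢ j) → ι 2 *ℚ F K ≡ ι 2 +ℚ ι 2 *ℚ Q +ℚ (F (w + x) +ℚ F l)
    centre K≢j pendent≢j = -≡0⇒≡ (trans (eq (F K) (F (w + x)) (F l) Q (Σ< (suc q) (λ s → F (k + s))) (Σ< (suc q) (λ _ → 1ℚ)))
      (1ℚ ⊛ centre′ K≢j ⊕ 1ℚ -ℚ F K ⊛ Σ<-const (suc q) 1ℚ
        ⊕ 1ℚ ⊛ Σ<-except q r₀ r₀<p (λ r r<p r≢r₀ → pendent r<p r≢r₀ (pendent≢j r≢r₀))))
      where
      eq : ∀ C E B q S D → ι 2 *ℚ C -ℚ (ι 2 +ℚ ι 2 *ℚ q +ℚ (E +ℚ B)) ≡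
        1ℚ *ℚ ((1ℚ +ℚ D) *ℚ C -ℚ (1ℚ +ℚ D +ℚ (E +ℚ S)))
        +ℚ (1ℚ -ℚ C) *ℚ (D -ℚ (1ℚ +ℚ q) *ℚ 1ℚ)
        +ℚ 1ℚ *ℚ (S -ℚ (q *ℚ (1ℚ +ℚ C) +ℚ B))
      eq = solve-∀ ℚ-ring

  hit-mid : ∀ i → i < w →
    c *ℚ hit (suc i + x) 0 ≡ c *ℚ (X *ℚ X) +ℚ
      (ι (suc i) *ℚ (Y -ℚ ι (suc i) +ℚ ι 2) *ℚ (ι 2 *ℚ X +ℚ c) +ℚ ι 2 *ℚ Q *ℚ ι (suc i) *ℚ (Y -ℚ ι (suc i)))
  -- The distance from the target to the centre is `suc t`.
  hit-mid i i<w with t , eq ← ℕ.m≤n⇒∃[o]m+o≡n i<w = from-0 (rescale {Y} {ι (suc i)} {ι (suc t)} {F x} {X} {Q} Y≡s+t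
      (to-path {Q} {ι (suc i)} {ι (suc t)} {F K} {F (w + x)} {δ₂} (leaf (vertex≢leaf r₀ j<k)) (centre (ℕ.>⇒≢ j<K) (λ {r} _ → vertex≢leaf r j<k ∘ sym))
        arc-end arc₂ (trans (A.total (suc i) ℕ.≤-refl) (cong (ι (suc i) *ℚ (F x -ℚ F (suc x)) +ℚ ι (suc i) *ℚ (ι (suc i) -ℚ 1ℚ) +ℚ_) (hit-target j)))))
    where
    j : ℕ
    j = suc i + x

    j<K : j < K
    j<K = ℕ.+-monoˡ-< x (s≤s i<w)

    j<k : j < k
    j<k = ℕ.m<n⇒m<1+n j<K

    open Beyond j (<k⇒<n j<k) (s≤s (ℕ.m≤n+m x i))
    module A = Arc (suc i) (ℕ.m<n⇒m<1+n i<w) (λ a<s → ℕ.<⇒≢ (ℕ.+-monoˡ-< x a<s))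

    end : t + j ≡ w + x
    end = begin
      t + (suc i + x)    ≡⟨ ℕ.+-assoc t (suc i) x ⟨
      t + suc i + x      ≡⟨ cong (_+ x) (ℕ.+-comm t (suc i)) ⟩
      suc i + t + x      ≡⟨ cong (_+ x) eq ⟩
      w + x              ∎

    Y≡s+t : Y ≡ ι (suc i) +ℚ ι (suc t)
    Y≡s+t = trans (cong (λ m → ι (suc m)) (sym eq)) (trans (cong ι (sym (ℕ.+-suc (suc i) t))) (ι-+ (suc i) (suc t)))

    -- No first-step equation is available at the target, so the arc from there to the centre gets
    -- its own unknown first difference.
    δ₂ : ℚ
    δ₂ = F j -ℚ F (suc j)

    start₂ : F j ≡ δ₂ +ℚ F (suc j)
    start₂ = split (F j) (F (suc j))
      where
      split : ∀ a b → a ≡ (a -ℚ b) +ℚ b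
      split = solve-∀ ℚ-ring

    module A₂ = Progression (λ a → F (a + j)) δ₂ (suc t) start₂
      (λ a a<t → step-path (a + j) (<k⇒<n j<k)
        (s≤s (ℕ.<-≤-trans (ℕ.+-monoˡ-< j (ℕ.s<s⁻¹ a<t)) (ℕ.≤-reflexive end)))
        (ℕ.>⇒≢ (s≤s (ℕ.m≤n+m j a))) (ℕ.>⇒≢ (s≤s (ℕ.≤-trans (ℕ.m≤n+m x (suc i)) (ℕ.m≤n+m j a)))))

    arc-end : F (w + x) ≡ δ₂ +ℚ ι 2 *ℚ (ι (suc t) -ℚ 1ℚ) +ℚ F K
    arc-end = trans (cong F (sym end)) (trans (A₂.difference t ℕ.≤-refl)
      (trans (pred δ₂ (ι t) (F (suc t + j))) (cong (λ v → δ₂ +ℚ ι 2 *ℚ (ι (suc t) -ℚ 1ℚ) +ℚ F (suc v)) end)))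
      where
      pred : ∀ d i f → d +ℚ ι 2 *ℚ i +ℚ f ≡ d +ℚ ι 2 *ℚ ((1ℚ +ℚ i) -ℚ 1ℚ) +ℚ f
      pred = solve-∀ ℚ-ring

    arc₂ : 0ℚ ≡ ι (suc t) *ℚ δ₂ +ℚ ι (suc t) *ℚ (ι (suc t) -ℚ 1ℚ) +ℚ F K
    arc₂ = trans (sym (hit-target j)) (trans (A₂.total (suc t) ℕ.≤-refl)
      (cong (λ v → ι (suc t) *ℚ δ₂ +ℚ ι (suc t) *ℚ (ι (suc t) -ℚ 1ℚ) +ℚ F (suc v)) end))

    rescale : ∀ {y s t a x q} → y ≡ s +ℚ t →
      (s +ℚ t +ℚ ι 2) *ℚ a ≡ s *ℚ (t +ℚ ι 2) *ℚ (ι 2 *ℚ x +ℚ (s +ℚ t +ℚ ι 2)) +ℚ ι 2 *ℚ q *ℚ s *ℚ t →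
      (y +ℚ ι 2) *ℚ a ≡ s *ℚ (y -ℚ s +ℚ ι 2) *ℚ (ι 2 *ℚ x +ℚ (y +ℚ ι 2)) +ℚ ι 2 *ℚ q *ℚ s *ℚ (y -ℚ s)
    rescale {s = s} {t} {a} {x} {q} refl h = trans h (simplify s t x q)
      where
      simplify : ∀ s t x q →
        s *ℚ (t +ℚ ι 2) *ℚ (ι 2 *ℚ x +ℚ (s +ℚ t +ℚ ι 2)) +ℚ ι 2 *ℚ q *ℚ s *ℚ t ≡
        s *ℚ (s +ℚ t -ℚ s +ℚ ι 2) *ℚ (ι 2 *ℚ x +ℚ (s +ℚ t +ℚ ι 2)) +ℚ ι 2 *ℚ q *ℚ s *ℚ (s +ℚ t -ℚ s)
      simplify = solve-∀ ℚ-ring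

  hit-centre : c *ℚ hit K 0 ≡ c *ℚ (X *ℚ X) +ℚ ι 2 *ℚ Y *ℚ (ι 2 *ℚ X +ℚ c)
  hit-centre = from-0 (drop {z = F K} {v = ι 2 *ℚ Y *ℚ (ι 2 *ℚ X +ℚ c)} (hit-target K) (to-centre {Y} {F K} (leaf (vertex≢leaf r₀ ℕ.≤-refl)) (A.total (suc w) ℕ.≤-refl)))
    where
    open Beyond K (<k⇒<n ℕ.≤-refl) x<K
    module A = Arc (suc w) ℕ.≤-refl (λ a<y → ℕ.<⇒≢ (ℕ.+-monoˡ-< x a<y))
    drop : ∀ {u z v} → z ≡ 0ℚ → u ≡ c *ℚ z +ℚ v → u ≡ v
    drop {v = v} refl h = trans h (eq c v)
      where
      eq : ∀ c v → c *ℚ 0ℚ +ℚ v ≡ v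
      eq = solve-∀ ℚ-ring

  module BeyondLeaf (r : ℕ) (r<p : r < suc q) where
    open Beyond (k + r) (leaf<n r<p) (ℕ.<-≤-trans (ℕ.m<n⇒m<1+n x<K) (ℕ.m≤m+n k r)) public
    private
      module A = Arc (suc w) ℕ.≤-refl (λ {a} a<y → vertex≢leaf r (ℕ.m<n⇒m<1+n (ℕ.+-monoˡ-< x a<y)))

    arc : F x ≡ Y *ℚ (F x -ℚ F (suc x)) +ℚ Y *ℚ (Y -ℚ 1ℚ) +ℚ F K
    arc = A.total (suc w) ℕ.≤-refl

    arc-end : F (w + x) ≡ F x -ℚ F (suc x) +ℚ ι 2 *ℚ (Y -ℚ 1ℚ) +ℚ F K
    arc-end = trans (A.difference w ℕ.≤-refl) (pred (F x -ℚ F (suc x)) (ι w) (F K))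
      where
      pred : ∀ d i f → d +ℚ ι 2 *ℚ i +ℚ f ≡ d +ℚ ι 2 *ℚ ((1ℚ +ℚ i) -ℚ 1ℚ) +ℚ f
      pred = solve-∀ ℚ-ring

  hit-leaf : c *ℚ hit l 0 ≡ c *ℚ (X *ℚ X) +ℚ ((Y +ℚ 1ℚ) *ℚ (ι 2 *ℚ X +ℚ c) +ℚ ι 2 *ℚ Q)
  hit-leaf = from-0 (to-leaf {Q} {Y} {F K} {F (w + x)} (centre (vertex≢leaf r₀ ℕ.≤-refl) (λ {r} r≢r₀ → r≢r₀ ∘ ℕ.+-cancelˡ-≡ k r r₀))
      arc-end arc (hit-target l))
    where open BeyondLeaf r₀ r₀<p

  hit-pendent : ∀ r → r < suc q → r ≢ r₀ →
    c *ℚ hit (k + r) 0 ≡ c *ℚ (X *ℚ X) +ℚ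
      (c *ℚ (ι 2 *ℚ Q +ℚ ι 2 *ℚ Y +ℚ ι 2 *ℚ X +ℚ ι 3) +ℚ ι 2 *ℚ Y *ℚ (ι 2 *ℚ X +ℚ c))
  hit-pendent r r<p r≢r₀ = from-0 (trans (to-centre {Y} {F K} (leaf j≢l) arc)
      (cong (λ z → c *ℚ z +ℚ ι 2 *ℚ Y *ℚ (ι 2 *ℚ X +ℚ c)) (centre-to-pendent {Q} {Y} {F K} {F (w + x)} centre₃ arc-end (leaf j≢l))))
    where
    open BeyondLeaf r r<p

    j≢l : k + r ≢ l
    j≢l = r≢r₀ ∘ ℕ.+-cancelˡ-≡ k r r₀

    -- The target's missing contribution 1 + F K is added so that r₀ is the only exceptional leaf.
    corrected : ℕ → ℚ
    corrected s = F (k + s) +ℚ 𝟙 (s ≡ᵇ r) *ℚ (1ℚ +ℚ F K)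

    corrected-const : ∀ s → s < suc q → s ≢ r₀ → corrected s ≡ 1ℚ +ℚ F K
    corrected-const s s<p s≢r₀ with s ℕ.≟ r
    ... | yes refl = trans (cong₂ (λ z b → z +ℚ 𝟙 b *ℚ (1ℚ +ℚ F K)) (hit-target (k + s)) (≡ᵇ-refl s)) (eq (F K))
      where
      eq : ∀ f → 0ℚ +ℚ 1ℚ *ℚ (1ℚ +ℚ f) ≡ 1ℚ +ℚ f
      eq = solve-∀ ℚ-ring
    ... | no s≢r = trans (cong₂ (λ z b → z +ℚ 𝟙 b *ℚ (1ℚ +ℚ F K)) (pendent s<p s≢r₀ (s≢r ∘ ℕ.+-cancelˡ-≡ k s r)) (≢⇒≡ᵇ s≢r)) (eq (F K))
      where
      eq : ∀ f → (1ℚ +ℚ f) +ℚ 0ℚ *ℚ (1ℚ +ℚ f) ≡ 1ℚ +ℚ f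
      eq = solve-∀ ℚ-ring

    leaves : Σ< (suc q) (λ s → F (k + s)) +ℚ (1ℚ +ℚ F K) ≡ Q *ℚ (1ℚ +ℚ F K) +ℚ F l
    leaves = begin
      Σ< (suc q) (λ s → F (k + s)) +ℚ (1ℚ +ℚ F K)   ≡⟨ cong (Σ< (suc q) (λ s → F (k + s)) +ℚ_) (Σ<-pick (suc q) r (λ _ → 1ℚ +ℚ F K) r<p) ⟨
      _                                             ≡⟨ Σ<-+ (suc q) (λ s → F (k + s)) (λ s → 𝟙 (s ≡ᵇ r) *ℚ (1ℚ +ℚ F K)) ⟨
      Σ< (suc q) corrected                          ≡⟨ Σ<-except q r₀ r₀<p corrected-const ⟩
      Q *ℚ (1ℚ +ℚ F K) +ℚ corrected r₀              ≡⟨ cong (λ b → Q *ℚ (1ℚ +ℚ F K) +ℚ (F l +ℚ 𝟙 b *ℚ (1ℚ +ℚ F K))) (≢⇒≡ᵇ (r≢r₀ ∘ sym)) ⟩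
      Q *ℚ (1ℚ +ℚ F K) +ℚ (F l +ℚ 0ℚ *ℚ (1ℚ +ℚ F K)) ≡⟨ eq (Q *ℚ (1ℚ +ℚ F K)) (F l) (1ℚ +ℚ F K) ⟩
      Q *ℚ (1ℚ +ℚ F K) +ℚ F l                       ∎
      where
      eq : ∀ a b d → a +ℚ (b +ℚ 0ℚ *ℚ d) ≡ a +ℚ b
      eq = solve-∀ ℚ-ring

    -- The target leaf contributes 0 instead of 1 + F K; this turns the coefficient 2 and the
    -- constant 2 + 2 Q of `centre` into 3 and 1 + 2 Q.
    centre₃ : ι 3 *ℚ F K ≡ ι 2 *ℚ Q +ℚ 1ℚ +ℚ (F (w + x) +ℚ F l)
    centre₃ = -≡0⇒≡ (trans (eq (F K) (F (w + x)) (F l) Q (Σ< (suc q) (λ s → F (k + s))) (Σ< (suc q) (λ _ → 1ℚ)))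
        (1ℚ ⊛ centre′ (vertex≢leaf r ℕ.≤-refl) ⊕ 1ℚ -ℚ F K ⊛ Σ<-const (suc q) 1ℚ ⊕ 1ℚ ⊛ leaves))
      where
      eq : ∀ C E B q S D → ι 3 *ℚ C -ℚ (ι 2 *ℚ q +ℚ 1ℚ +ℚ (E +ℚ B)) ≡
        1ℚ *ℚ ((1ℚ +ℚ D) *ℚ C -ℚ (1ℚ +ℚ D +ℚ (E +ℚ S)))
        +ℚ (1ℚ -ℚ C) *ℚ (D -ℚ (1ℚ +ℚ q) *ℚ 1ℚ)
        +ℚ 1ℚ *ℚ (S +ℚ (1ℚ +ℚ C) -ℚ (q *ℚ (1ℚ +ℚ C) +ℚ B))
      eq = solve-∀ ℚ-ring

-- Sign of the gap

+-nonneg : ∀ {a b} → 0ℚ ≤ℚ a → 0ℚ ≤ℚ b → 0ℚ ≤ℚ a +ℚ b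
+-nonneg = ℚ.+-mono-≤

*-nonneg : ∀ {a b} → 0ℚ ≤ℚ a → 0ℚ ≤ℚ b → 0ℚ ≤ℚ a *ℚ b
*-nonneg {a} {b} 0≤a 0≤b = ℚ.≤-trans (ℚ.≤-reflexive (sym (ℚ.*-zeroʳ a)))
  (ℚ.*-monoˡ-≤-nonNeg a ⦃ nonNegative 0≤a ⦄ 0≤b)

0≤degree : ∀ n g a → 0ℚ ≤ℚ degree n g a
0≤degree n g a = Σ<-nonneg n λ b _ → *-nonneg (0≤𝟙 (g a b)) (0≤ι 1)

-- 3 c (κ⁺ S⁺ − κ S) in terms of x, y and q = p - 1.
gap : ℚ → ℚ → ℚ → ℚ
gap X Y Q =
  ι 6 *ℚ (Y +ℚ ι 2) *ℚ X *ℚ X -ℚ ι 12 *ℚ Q *ℚ X *ℚ Y *ℚ Y -ℚ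
  ((Y +ℚ ι 2) *ℚ (ι 4 *ℚ X *ℚ Y *ℚ (Y +ℚ 1ℚ) +ℚ Y *ℚ Y *ℚ Y -ℚ ι 4 *ℚ Y -ℚ ι 3) +ℚ Q *ℚ (ι 4 *ℚ Y *ℚ Y *ℚ Y -ℚ ι 22 *ℚ Y -ℚ ι 12))

-- From x ≤ q y follows 12 q x y² ≥ 12 x² y, which dominates 6 (y + 2) x² once y ≥ 2. The bound y ≥
-- 3 comes from the coefficient 4 y³ - 22 y - 12 of q, which is -24 at y = 2 and 30 at y = 3.
gap-nonpos : ∀ x q z → x ≤ q * (3 + z) → gap (ι x) (ι (3 + z)) (ι q) ≤ℚ 0ℚ
gap-nonpos x q z x≤qy = ℚ.≤-trans
    (ℚ.≤-trans (ℚ.≤-reflexive (sym (ℚ.+-identityʳ (gap X Y Q)))) (ℚ.+-monoʳ-≤ (gap X Y Q) deficit≥0))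
    (ℚ.≤-reflexive (cancel X Q Z))
  where
  X = ι x
  Q = ι q
  Z = ι z
  Y = ι (3 + z)

  -- − gap written as a sum of terms that are visibly nonnegative when x ≤ q y and y = 3 + z.
  cancel : ∀ X Q Z → let Y = 1ℚ +ℚ (1ℚ +ℚ (1ℚ +ℚ Z)) in
    ι 6 *ℚ (Y +ℚ ι 2) *ℚ X *ℚ X -ℚ ι 12 *ℚ Q *ℚ X *ℚ Y *ℚ Y -ℚ
    ((Y +ℚ ι 2) *ℚ (ι 4 *ℚ X *ℚ Y *ℚ (Y +ℚ 1ℚ) +ℚ Y *ℚ Y *ℚ Y -ℚ ι 4 *ℚ Y -ℚ ι 3) +ℚ Q *ℚ (ι 4 *ℚ Y *ℚ Y *ℚ Y -ℚ ι 22 *ℚ Y -ℚ ι 12))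
    +ℚ ((ι 5 +ℚ Z) *ℚ X *ℚ (ι 4 *ℚ (ι 3 +ℚ Z) *ℚ (ι 4 +ℚ Z))
    +ℚ (ι 5 +ℚ Z) *ℚ (ι 12 +ℚ Z *ℚ (ι 23 +ℚ Z *ℚ (ι 9 +ℚ Z)))
    +ℚ Q *ℚ (ι 30 +ℚ Z *ℚ (ι 86 +ℚ Z *ℚ (ι 36 +ℚ ι 4 *ℚ Z)))
    +ℚ ι 6 *ℚ X *ℚ (ι 2 *ℚ (ι 3 +ℚ Z) *ℚ (Q *ℚ (ι 3 +ℚ Z) -ℚ X) +ℚ (1ℚ +ℚ Z) *ℚ X)) ≡ 0ℚ
  cancel = solve-∀ ℚ-ring

  slack : 0ℚ ≤ℚ Q *ℚ (ι 3 +ℚ Z) -ℚ X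
  slack = ℚ.≤-trans (ℚ.≤-reflexive (sym (ℚ.+-inverseʳ X)))
    (ℚ.+-monoˡ-≤ (- X) (ℚ.≤-trans (ι-mono-≤ x≤qy) (ℚ.≤-reflexive (trans (ι-* q (3 + z)) (cong (Q *ℚ_) (ι-+ 3 z))))))

  infixl 6 _⊞_
  infixl 7 _⊠_
  _⊞_ = +-nonneg
  _⊠_ = *-nonneg
  X≥0 = 0≤ι x
  Z≥0 = 0≤ι z

  deficit≥0 =
    (0≤ι 5 ⊞ Z≥0) ⊠ X≥0 ⊠ (0≤ι 4 ⊠ (0≤ι 3 ⊞ Z≥0) ⊠ (0≤ι 4 ⊞ Z≥0))
    ⊞ (0≤ι 5 ⊞ Z≥0) ⊠ (0≤ι 12 ⊞ Z≥0 ⊠ (0≤ι 23 ⊞ Z≥0 ⊠ (0≤ι 9 ⊞ Z≥0)))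
    ⊞ 0≤ι q ⊠ (0≤ι 30 ⊞ Z≥0 ⊠ (0≤ι 86 ⊞ Z≥0 ⊠ (0≤ι 36 ⊞ 0≤ι 4 ⊠ Z≥0)))
    ⊞ 0≤ι 6 ⊠ X≥0 ⊠ (0≤ι 2 ⊠ (0≤ι 3 ⊞ Z≥0) ⊠ slack ⊞ (0≤ι 1 ⊞ Z≥0) ⊠ X≥0)

-- Comparison of the two Kemeny constants

module Comparison (w x q r₀ : ℕ) (r₀<p : r₀ < suc q) {κ κ⁺ : ℚ}
  (H : HittingTimes (suc (suc w + x) + suc q) (broomᵇ (suc (suc w + x))) κ)
  (H⁺ : HittingTimes (suc (suc w + x) + suc q) (addEdgeᵇ (broomᵇ (suc (suc w + x))) x (suc (suc w + x) + r₀)) κ⁺) where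
  private
    K = suc w + x
    k = suc K
    n = k + suc q
    l = k + r₀
    X = ι x
    Y = ι (suc w)
    Q = ι q
    c = Y +ℚ ι 2

  open HittingTimes
  open BroomNbr K (suc q)
  open CycleNbr w x q r₀ r₀<p
  module B = BroomTimes (w + x) q H
  module C = CycleTimes w x q r₀ r₀<p H⁺

  D D⁺ : ℕ → ℚ
  D  = degree n (broomᵇ k)
  D⁺ = degree n g⁺

  -- The factor c clears the denominators of the hitting times around the cycle, and 3 the
  -- denominator left by the sum of squares in `midSum`.
  U : ℕ → ℚ
  U j = ι 3 *ℚ c *ℚ (hit H⁺ j 0 *ℚ D⁺ j -ℚ hit H j 0 *ℚ D j)

  private
    evaluate : ∀ {h⁺ h d⁺ d} R V e⁺ e → c *ℚ h⁺ ≡ R → h ≡ V → d⁺ ≡ e⁺ → d ≡ e →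
      ι 3 *ℚ c *ℚ (h⁺ *ℚ d⁺ -ℚ h *ℚ d) ≡ ι 3 *ℚ (R *ℚ e⁺ -ℚ c *ℚ (V *ℚ e))
    evaluate {h⁺} R V e⁺ e refl refl refl refl = eq c h⁺ V e⁺ e
      where
      eq : ∀ c h⁺ V e⁺ e → ι 3 *ℚ c *ℚ (h⁺ *ℚ e⁺ -ℚ V *ℚ e) ≡ ι 3 *ℚ (c *ℚ h⁺ *ℚ e⁺ -ℚ c *ℚ (V *ℚ e))
      eq = solve-∀ ℚ-ring

    one : ℕ → ℚ
    one _ = 1ℚ

    D-centre : 1ℚ +ℚ Σ< (suc q) one ≡ ι 2 +ℚ Q
    D-centre = trans (cong (1ℚ +ℚ_) (Σ<-const (suc q) 1ℚ)) (eq Q)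
      where
      eq : ∀ q → 1ℚ +ℚ (1ℚ +ℚ q) *ℚ 1ℚ ≡ ι 2 +ℚ q
      eq = solve-∀ ℚ-ring

    old : ℚ
    old = (Y +ℚ X) *ℚ (Y +ℚ X) +ℚ (ι 2 *ℚ (Y +ℚ X) +ℚ ι 2 *ℚ Q +ℚ 1ℚ)

    hit-leaf-old : ∀ r → r < suc q → hit H (k + r) 0 ≡ old
    hit-leaf-old r r<p = trans (B.hit-leaf r r<p) (cong (λ z → z *ℚ z +ℚ (ι 2 *ℚ z +ℚ ι 2 *ℚ Q +ℚ 1ℚ)) (ι-+ (suc w) x))

    hit-path-old : ∀ s → s ≤ suc w → hit H (s + x) 0 ≡ (ι s +ℚ X) *ℚ (ι s +ℚ X)
    hit-path-old s s≤y = trans (B.hit-path (s + x) (ℕ.+-monoˡ-≤ x s≤y)) (cong (λ z → z *ℚ z) (ι-+ s x))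

    U-low : ∀ a → a < x → U a ≡ 0ℚ
    U-low a a<x = trans
      (cong₂ (λ h d → ι 3 *ℚ c *ℚ (h *ℚ d -ℚ hit H a 0 *ℚ D a)) (trans (C.hit-low a (ℕ.<⇒≤ a<x)) (sym (B.hit-path a (ℕ.<⇒≤ a<K))))
        (N⁺-other one (ℕ.<⇒≢ a<x) (vertex≢leaf r₀ (ℕ.m<n⇒m<1+n a<K))))
      (eq (ι 3 *ℚ c) (hit H a 0 *ℚ D a))
      where
      a<K : a < K
      a<K = ℕ.<-trans a<x x<K
      eq : ∀ c u → c *ℚ (u -ℚ u) ≡ 0ℚ
      eq = solve-∀ ℚ-ring

    U-x : U x ≡ ι 3 *ℚ c *ℚ (X *ℚ X)
    U-x = trans (cong₂ (λ h⁺ h → ι 3 *ℚ c *ℚ (h⁺ *ℚ D⁺ x -ℚ h *ℚ D x)) (C.hit-low x ℕ.≤-refl) (B.hit-path x (ℕ.<⇒≤ x<K)))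
      (trans (cong (λ d → ι 3 *ℚ c *ℚ (X *ℚ X *ℚ d -ℚ X *ℚ X *ℚ D x)) (N⁺-x one)) (eq c X (D x)))
      where
      eq : ∀ c x d → ι 3 *ℚ c *ℚ (x *ℚ x *ℚ (d +ℚ 1ℚ) -ℚ x *ℚ x *ℚ d) ≡ ι 3 *ℚ c *ℚ (x *ℚ x)
      eq = solve-∀ ℚ-ring

    mid : ℚ → ℚ
    mid s = ι 3 *ℚ ((c *ℚ (X *ℚ X) +ℚ (s *ℚ (Y -ℚ s +ℚ ι 2) *ℚ (ι 2 *ℚ X +ℚ c) +ℚ ι 2 *ℚ Q *ℚ s *ℚ (Y -ℚ s))) *ℚ ι 2
      -ℚ c *ℚ ((s +ℚ X) *ℚ (s +ℚ X) *ℚ ι 2))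

    U-mid : ∀ i → i < w → U (suc i + x) ≡ mid (ι (suc i))
    U-mid i i<w = evaluate _ _ _ _ (C.hit-mid i i<w) (hit-path-old (suc i) (ℕ.m<n⇒m<1+n i<w))
      (N⁺-path one i<K (ℕ.>⇒≢ (s≤s (ℕ.m≤n+m x i)))) (N-path one (i + x) i<K)
      where
      i<K : suc i + x < K
      i<K = ℕ.+-monoˡ-< x (s≤s i<w)

    -- `mid s` is 6 (c² + 2 Q Y) s - 6 (2 c + 2 X + 2 Q) s², without constant term; the sums of the
    -- first integers and of their squares give this closed form.
    midSum : ℚ → ℚ
    midSum i = ι 3 *ℚ i *ℚ (i +ℚ 1ℚ) *ℚ (c *ℚ c +ℚ ι 2 *ℚ Q *ℚ Y)
      -ℚ i *ℚ (i +ℚ 1ℚ) *ℚ (ι 2 *ℚ i +ℚ 1ℚ) *ℚ (ι 2 *ℚ c +ℚ ι 2 *ℚ X +ℚ ι 2 *ℚ Q)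

    U-mids : Σ< w (λ i → U (suc i + x)) ≡ midSum (ι w)
    U-mids = trans (Σ<-cong w U-mid) (Σ<-telescope w (midSum ∘ ι) (start Y X Q) (λ i _ → step Y X Q (ι i)))
      where
      start : ∀ Y X Q → let c = Y +ℚ ι 2; i = 0ℚ in
        ι 3 *ℚ i *ℚ (i +ℚ 1ℚ) *ℚ (c *ℚ c +ℚ ι 2 *ℚ Q *ℚ Y)
        -ℚ i *ℚ (i +ℚ 1ℚ) *ℚ (ι 2 *ℚ i +ℚ 1ℚ) *ℚ (ι 2 *ℚ c +ℚ ι 2 *ℚ X +ℚ ι 2 *ℚ Q) ≡ 0ℚ
      start = solve-∀ ℚ-ring
      step : ∀ Y X Q i → let c = Y +ℚ ι 2; s = 1ℚ +ℚ i in
        ι 3 *ℚ s *ℚ (s +ℚ 1ℚ) *ℚ (c *ℚ c +ℚ ι 2 *ℚ Q *ℚ Y)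
        -ℚ s *ℚ (s +ℚ 1ℚ) *ℚ (ι 2 *ℚ s +ℚ 1ℚ) *ℚ (ι 2 *ℚ c +ℚ ι 2 *ℚ X +ℚ ι 2 *ℚ Q) ≡
        ι 3 *ℚ i *ℚ (i +ℚ 1ℚ) *ℚ (c *ℚ c +ℚ ι 2 *ℚ Q *ℚ Y)
        -ℚ i *ℚ (i +ℚ 1ℚ) *ℚ (ι 2 *ℚ i +ℚ 1ℚ) *ℚ (ι 2 *ℚ c +ℚ ι 2 *ℚ X +ℚ ι 2 *ℚ Q)
        +ℚ ι 3 *ℚ ((c *ℚ (X *ℚ X) +ℚ (s *ℚ (Y -ℚ s +ℚ ι 2) *ℚ (ι 2 *ℚ X +ℚ c) +ℚ ι 2 *ℚ Q *ℚ s *ℚ (Y -ℚ s))) *ℚ ι 2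
          -ℚ c *ℚ ((s +ℚ X) *ℚ (s +ℚ X) *ℚ ι 2))
      step = solve-∀ ℚ-ring

    centreVal : ℚ
    centreVal = ι 3 *ℚ ((c *ℚ (X *ℚ X) +ℚ ι 2 *ℚ Y *ℚ (ι 2 *ℚ X +ℚ c)) *ℚ (ι 2 +ℚ Q) -ℚ c *ℚ ((Y +ℚ X) *ℚ (Y +ℚ X) *ℚ (ι 2 +ℚ Q)))

    U-centre : U K ≡ centreVal
    U-centre = evaluate _ _ _ _ C.hit-centre (hit-path-old (suc w) ℕ.≤-refl)
      (trans (N⁺-centre one) D-centre) (trans (N-centre one (w + x) refl) D-centre)

    pendentVal : ℚ
    pendentVal = ι 3 *ℚ ((c *ℚ (X *ℚ X) +ℚ (c *ℚ (ι 2 *ℚ Q +ℚ ι 2 *ℚ Y +ℚ ι 2 *ℚ X +ℚ ι 3) +ℚ ι 2 *ℚ Y *ℚ (ι 2 *ℚ X +ℚ c))) *ℚ 1ℚ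
      -ℚ c *ℚ (old *ℚ 1ℚ))

    U-pendent : ∀ r → r < suc q → r ≢ r₀ → U (k + r) ≡ pendentVal
    U-pendent r r<p r≢r₀ = evaluate _ _ _ _ (C.hit-pendent r r<p r≢r₀) (hit-leaf-old r r<p) (N⁺-pendent one r≢r₀) (N-leaf one r)

    leafVal : ℚ
    leafVal = ι 3 *ℚ ((c *ℚ (X *ℚ X) +ℚ ((Y +ℚ 1ℚ) *ℚ (ι 2 *ℚ X +ℚ c) +ℚ ι 2 *ℚ Q)) *ℚ ι 2 -ℚ c *ℚ (old *ℚ 1ℚ))

    U-leaf : U l ≡ leafVal
    U-leaf = evaluate _ _ _ _ C.hit-leaf (hit-leaf-old r₀ r₀<p) (N⁺-l one) (N-leaf one r₀)

    U-path : Σ< K U ≡ 0ℚ +ℚ (ι 3 *ℚ c *ℚ (X *ℚ X) +ℚ midSum (ι w))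
    U-path = begin
      Σ< (suc w + x) U                           ≡⟨ cong (λ m → Σ< m U) (ℕ.+-comm (suc w) x) ⟩
      Σ< (x + suc w) U                           ≡⟨ Σ<-++ x (suc w) U ⟩
      Σ< x U +ℚ Σ< (suc w) (λ a → U (x + a))     ≡⟨ cong₂ _+ℚ_ (Σ<-0 x U-low) (Σ<-cong (suc w) (λ a _ → cong U (ℕ.+-comm x a))) ⟩
      0ℚ +ℚ Σ< (suc w) (λ a → U (a + x))         ≡⟨ cong (0ℚ +ℚ_) (cong₂ _+ℚ_ U-x U-mids) ⟩
      0ℚ +ℚ (ι 3 *ℚ c *ℚ (X *ℚ X) +ℚ midSum (ι w)) ∎

  U-total : Σ< n U ≡ gap X Y Q
  U-total = begin
    Σ< n U                                            ≡⟨ Σ<-++ k (suc q) U ⟩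
    Σ< k U +ℚ Σ< (suc q) (λ r → U (k + r))            ≡⟨ cong₂ _+ℚ_ (Σ<-last K U) (Σ<-except q r₀ r₀<p U-pendent) ⟩
    Σ< K U +ℚ U K +ℚ (Q *ℚ pendentVal +ℚ U l)         ≡⟨ cong₂ _+ℚ_ (cong₂ _+ℚ_ U-path U-centre) (cong (Q *ℚ pendentVal +ℚ_) U-leaf) ⟩
    0ℚ +ℚ (ι 3 *ℚ c *ℚ (X *ℚ X) +ℚ midSum (ι w)) +ℚ centreVal +ℚ (Q *ℚ pendentVal +ℚ leafVal)
                                                      ≡⟨ collect X (ι w) Q ⟩
    gap X Y Q                                         ∎
    where
    collect : ∀ X W Q → let Y = 1ℚ +ℚ W; c = Y +ℚ ι 2; old = (Y +ℚ X) *ℚ (Y +ℚ X) +ℚ (ι 2 *ℚ (Y +ℚ X) +ℚ ι 2 *ℚ Q +ℚ 1ℚ) in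
      0ℚ +ℚ (ι 3 *ℚ c *ℚ (X *ℚ X) +ℚ (ι 3 *ℚ W *ℚ (W +ℚ 1ℚ) *ℚ (c *ℚ c +ℚ ι 2 *ℚ Q *ℚ Y)
        -ℚ W *ℚ (W +ℚ 1ℚ) *ℚ (ι 2 *ℚ W +ℚ 1ℚ) *ℚ (ι 2 *ℚ c +ℚ ι 2 *ℚ X +ℚ ι 2 *ℚ Q))) +ℚ
      ι 3 *ℚ ((c *ℚ (X *ℚ X) +ℚ ι 2 *ℚ Y *ℚ (ι 2 *ℚ X +ℚ c)) *ℚ (ι 2 +ℚ Q) -ℚ c *ℚ ((Y +ℚ X) *ℚ (Y +ℚ X) *ℚ (ι 2 +ℚ Q))) +ℚ
      (Q *ℚ (ι 3 *ℚ ((c *ℚ (X *ℚ X) +ℚ (c *ℚ (ι 2 *ℚ Q +ℚ ι 2 *ℚ Y +ℚ ι 2 *ℚ X +ℚ ι 3) +ℚ ι 2 *ℚ Y *ℚ (ι 2 *ℚ X +ℚ c))) *ℚ 1ℚ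
        -ℚ c *ℚ (old *ℚ 1ℚ))) +ℚ
       ι 3 *ℚ ((c *ℚ (X *ℚ X) +ℚ ((Y +ℚ 1ℚ) *ℚ (ι 2 *ℚ X +ℚ c) +ℚ ι 2 *ℚ Q)) *ℚ ι 2 -ℚ c *ℚ (old *ℚ 1ℚ))) ≡
      ι 6 *ℚ (Y +ℚ ι 2) *ℚ X *ℚ X -ℚ ι 12 *ℚ Q *ℚ X *ℚ Y *ℚ Y -ℚ
      ((Y +ℚ ι 2) *ℚ (ι 4 *ℚ X *ℚ Y *ℚ (Y +ℚ 1ℚ) +ℚ Y *ℚ Y *ℚ Y -ℚ ι 4 *ℚ Y -ℚ ι 3) +ℚ Q *ℚ (ι 4 *ℚ Y *ℚ Y *ℚ Y -ℚ ι 22 *ℚ Y -ℚ ι 12))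
    collect = solve-∀ ℚ-ring

  private
    -- Vertex 0 alone contributes degree 1.
    0<S : 0ℚ <ℚ Σ< n D
    0<S = ℚ.<-≤-trans (ℚ.positive⁻¹ 1ℚ) (ℚ.≤-trans (ℚ.≤-reflexive (sym (ℚ.+-identityʳ 1ℚ)))
      (ℚ.+-mono-≤ (ℚ.≤-reflexive (sym (N-start one (s≤s z≤n)))) (Σ<-nonneg (K + suc q) λ a _ → 0≤degree n (broomᵇ k) (suc a))))

    S≤S⁺ : Σ< n D ≤ℚ Σ< n D⁺
    S≤S⁺ = Σ<-mono-≤ n λ a _ → ℚ.≤-trans
      (ℚ.≤-trans (ℚ.≤-reflexive (sym (ℚ.+-identityʳ (D a))))
        (ℚ.+-monoʳ-≤ (D a) (+-nonneg (*-nonneg (0≤𝟙 (a ≡ᵇ x)) (0≤ι 1)) (*-nonneg (0≤𝟙 (a ≡ᵇ l)) (0≤ι 1)))))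
      (ℚ.≤-reflexive (sym (N⁺-split one a)))

    W W⁺ : ℚ
    W  = Σ< n (λ j → hit H j 0 *ℚ D j)
    W⁺ = Σ< n (λ j → hit H⁺ j 0 *ℚ D⁺ j)

    -- `HittingTimes` carries no sign condition; nonnegativity is visible in the closed forms for
    -- the broom.
    0≤W : 0ℚ ≤ℚ W
    0≤W = ℚ.≤-trans (+-nonneg
        (Σ<-nonneg k λ j j<k → *-nonneg (nonneg-≡ (B.hit-path j (ℕ.s≤s⁻¹ j<k)) (*-nonneg (0≤ι j) (0≤ι j))) (0≤degree n (broomᵇ k) j))
        (Σ<-nonneg (suc q) λ r r<p → *-nonneg (nonneg-≡ (B.hit-leaf r r<p)
          (+-nonneg (*-nonneg (0≤ι K) (0≤ι K)) (+-nonneg (+-nonneg (*-nonneg (0≤ι 2) (0≤ι K)) (*-nonneg (0≤ι 2) (0≤ι q))) (0≤ι 1))))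
          (0≤degree n (broomᵇ k) (k + r))))
      (ℚ.≤-reflexive (sym (Σ<-++ k (suc q) (λ j → hit H j 0 *ℚ D j))))
      where
      nonneg-≡ : ∀ {a b} → a ≡ b → 0ℚ ≤ℚ b → 0ℚ ≤ℚ a
      nonneg-≡ refl 0≤b = 0≤b

    -- The chain is W = κ S ≤ κ S⁺ < κ⁺ S⁺ = W⁺, whose middle steps use 0 ≤ κ and 0 < S⁺.
    W<W⁺ : κ <ℚ κ⁺ → W <ℚ W⁺
    W<W⁺ κ<κ⁺ = ℚ.≤-<-trans
      (ℚ.≤-trans (ℚ.≤-reflexive (sym (kemeny H))) (ℚ.*-monoˡ-≤-nonNeg κ ⦃ nonNegative 0≤κ ⦄ S≤S⁺))
      (ℚ.<-≤-trans (ℚ.*-monoˡ-<-pos (Σ< n D⁺) ⦃ positive (ℚ.<-≤-trans 0<S S≤S⁺) ⦄ κ<κ⁺) (ℚ.≤-reflexive (kemeny H⁺)))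
      where
      0≤κ : 0ℚ ≤ℚ κ
      0≤κ = ℚ.*-cancelʳ-≤-pos (Σ< n D) ⦃ positive 0<S ⦄
        (ℚ.≤-trans (ℚ.≤-reflexive (ℚ.*-zeroˡ (Σ< n D))) (ℚ.≤-trans 0≤W (ℚ.≤-reflexive (sym (kemeny H)))))

  gap-positive : κ <ℚ κ⁺ → 0ℚ <ℚ gap X Y Q
  gap-positive κ<κ⁺ = ℚ.<-≤-trans
    (ℚ.≤-<-trans (ℚ.≤-reflexive (sym (trans (cong (ι 3 *ℚ c *ℚ_) (ℚ.+-inverseʳ W)) (ℚ.*-zeroʳ (ι 3 *ℚ c)))))
      (ℚ.*-monoʳ-<-pos (ι 3 *ℚ c) ⦃ positive 0<3c ⦄ (ℚ.+-monoˡ-< (- W) (W<W⁺ κ<κ⁺))))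
    (ℚ.≤-reflexive (trans (sym U-sum) U-total))
    where
    U-sum : Σ< n U ≡ ι 3 *ℚ c *ℚ (W⁺ -ℚ W)
    U-sum = trans (Σ<-*ˡ n (ι 3 *ℚ c) (λ j → hit H⁺ j 0 *ℚ D⁺ j -ℚ hit H j 0 *ℚ D j)) (cong (ι 3 *ℚ c *ℚ_) (Σ<-minus n (λ j → hit H⁺ j 0 *ℚ D⁺ j) (λ j → hit H j 0 *ℚ D j)))
    0<3c : 0ℚ <ℚ ι 3 *ℚ c
    0<3c = ℚ.<-≤-trans (ℚ.positive⁻¹ (ι 6)) (ℚ.≤-trans (ℚ.≤-reflexive (sym (ℚ.+-identityˡ (ι 6))))
      (ℚ.≤-trans (ℚ.+-monoˡ-≤ (ι 6) (*-nonneg (0≤ι 3) (0≤ι (suc w)))) (ℚ.≤-reflexive (sym (ℚ.*-distribˡ-+ (ι 3) Y (ι 2))))))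

braess-bound : ∀ w x q r → r < suc q → ∀ {κ κ⁺} →
  HittingTimes (suc (suc w + x) + suc q) (broomᵇ (suc (suc w + x))) κ →
  HittingTimes (suc (suc w + x) + suc q) (addEdgeᵇ (broomᵇ (suc (suc w + x))) x (suc (suc w + x) + r)) κ⁺ →
  κ <ℚ κ⁺ → suc w ≤ 2 ⊎ q * suc w < x
braess-bound zero          x q r r<p H H⁺ κ<κ⁺ = inj₁ (s≤s z≤n)
braess-bound (suc zero)    x q r r<p H H⁺ κ<κ⁺ = inj₁ (s≤s (s≤s z≤n))
braess-bound (suc (suc z)) x q r r<p H H⁺ κ<κ⁺ = inj₂ (ℕ.≰⇒> λ x≤qy →
  ℚ.<-irrefl refl (ℚ.<-≤-trans (Comparison.gap-positive (suc (suc z)) x q r r<p H H⁺ κ<κ⁺) (gap-nonpos x q z x≤qy)))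

-- Counting the Braess edges

ℕ→ℚ-cancel-≤ : ∀ {m n} → ℕ→ℚ m ≤ℚ ℕ→ℚ n → m ≤ n
ℕ→ℚ-cancel-≤ {m} {n} m≤n
  rewrite ℚ.normalize-coprime (coprime-sym (1-coprimeTo m)) | ℚ.normalize-coprime (coprime-sym (1-coprimeTo n))
  with ℤm≤ℤn ← ℚ.drop-*≤* m≤n rewrite ℤ.*-identityʳ (ℤ.+ m) | ℤ.*-identityʳ (ℤ.+ n) = ℤ.drop‿+≤+ ℤm≤ℤn

lookup-unique : ∀ {a} {A : Set a} {xs : List A} → Unique xs → ∀ i j → lookup xs i ≡ lookup xs j → i ≡ j
lookup-unique (x∉xs ∷ _)  Fin.zero    Fin.zero    _  = refl
lookup-unique (x∉xs ∷ _)  Fin.zero    (Fin.suc j) eq = contradiction eq (All.lookup x∉xs (∈-lookup j))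
lookup-unique (x∉xs ∷ _)  (Fin.suc i) Fin.zero    eq = contradiction (sym eq) (All.lookup x∉xs (∈-lookup i))
lookup-unique (_ ∷ uniq)  (Fin.suc i) (Fin.suc j) eq = cong Fin.suc (lookup-unique uniq i j eq)

-- Pigeonhole: composing positions in a duplicate-free list with `f` gives an injection into
-- `Fin c`.
length-≤ : ∀ {a p} {A : Set a} {P : A → Set p} (f : A → ℕ) c →
  (∀ {x} → P x → f x < c) → (∀ {x y} → P x → P y → f x ≡ f y → x ≡ y) →
  ∀ xs → Unique xs → All P xs → length xs ≤ c
length-≤ f c bound inj xs uniq all = injective⇒≤ {f = λ i → fromℕ< (bound (P-at i))} λ {i} {j} eq →
  lookup-unique uniq i j (inj (P-at i) (P-at j) (fromℕ<-injective _ _ (bound (P-at i)) (bound (P-at j)) eq))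
  where
  P-at : ∀ i → _
  P-at i = All.lookup all (∈-lookup i)

braess⇒bound : ∀ w x q r → 1 ≤ q → suc q ≤ suc (suc w + x) → r < suc q → ∀ {i l} →
  toℕ i ≡ x → toℕ l ≡ suc (suc w + x) + r →
  IsBraess (broom (suc (suc w + x)) (suc q)) i l → suc w * suc q ≤ 2 * suc (suc w + x)
braess⇒bound w x q r 1≤q p≤k r<p {i} {l} i≡x l≡k+r (_ , _ , κ , κ⁺ , kem , kem⁺ , κ<κ⁺) =
  [ (λ y≤2 → ℕ.*-mono-≤ y≤2 p≤k) , double ]′ (braess-bound w x q r r<p (hittingTimes (λ _ _ → refl) kem) H⁺ κ<κ⁺)
  where
  k = suc (suc w + x)

  H⁺ : HittingTimes (k + suc q) (addEdgeᵇ (broomᵇ k) x (k + r)) κ⁺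
  H⁺ = subst₂ (λ u v → HittingTimes (k + suc q) (addEdgeᵇ (broomᵇ k) u v) κ⁺) i≡x l≡k+r
    (hittingTimes (addEdge-toℕ (broom k (suc q)) (broomᵇ k) (λ _ _ → refl) i l) kem⁺)

  -- Since 1 ≤ q, the product p y = y + q y is at most 2 q y, and q y < x ≤ k.
  double : q * suc w < x → suc w * suc q ≤ 2 * k
  double qy<x = ℕ.≤-trans (ℕ.≤-reflexive (ℕ.*-comm (suc w) (suc q)))
    (ℕ.≤-trans (ℕ.+-mono-≤ (ℕ.≤-trans (ℕ.m≤n*m (suc w) q ⦃ ℕ.>-nonZero 1≤q ⦄) qy≤k) qy≤k)
      (ℕ.≤-reflexive (cong (k +_) (sym (ℕ.+-identityʳ k)))))
    where
    qy≤k : q * suc w ≤ k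
    qy≤k = ℕ.≤-trans (ℕ.<⇒≤ qy<x) (ℕ.≤-trans (ℕ.m≤n+m x (suc w)) (ℕ.n≤1+n (suc w + x)))

record Coordinates (k p : ℕ) (i l : Fin (k + p)) : Set where
  field
    w r   : ℕ
    k≡    : k ≡ suc (suc w + toℕ i)
    l≡    : toℕ l ≡ k + r
    r<p   : r < p
    bound : suc w * p ≤ 2 * k

coordinates : ∀ {k p} → 2 ≤ p → p ≤ k → ∀ {i l} → Type2Braess k p (i , l) → Coordinates k p i l
coordinates {k} {p} 2≤p p≤k {i} {l} (i<k , k≤l , braess)
  with y , i+y ← ℕ.m≤n⇒∃[o]m+o≡n i<k | r , k+r ← ℕ.m≤n⇒∃[o]m+o≡n k≤l =
  coordinates′ y r 2≤p p≤k (trans (sym i+y) (cong suc (ℕ.+-comm (toℕ i) y))) refl (sym k+r) braess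
  where
  coordinates′ : ∀ {k p} y r {x} → 2 ≤ p → p ≤ k → k ≡ suc (y + x) → ∀ {i l} → toℕ i ≡ x → toℕ l ≡ k + r →
    IsBraess (broom k p) i l → Coordinates k p i l
  -- At distance 0 the path vertex is the centre, which is already adjacent to every pendent vertex.
  coordinates′ {p = p} zero r {x} 2≤p p≤k refl {i} {l} i≡x l≡k+r (_ , nonadj , _) =
    contradiction (trans (sym nonadj) adjacent) λ ()
    where
    adjacent : broom (suc x) p i l ≡ true
    adjacent = trans (cong₂ (broomᵇ (suc x)) i≡x l≡k+r)
      (trans (BroomNbr.broomᵇ-path-leaf x p r ℕ.≤-refl) (≡ᵇ-refl x))
  coordinates′ {p = suc q} (suc w) r (s≤s 1≤q) p≤k refl {i} {l} i≡x l≡k+r braess = record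
    { w = w; r = r; k≡ = cong (λ z → suc (suc w + z)) (sym i≡x); l≡ = l≡k+r; r<p = r<p
    ; bound = braess⇒bound w _ q r 1≤q p≤k r<p i≡x l≡k+r braess }
    where
    r<p : r < suc q
    r<p = ℕ.+-cancelˡ-< _ r (suc q) (subst (_< _) l≡k+r (toℕ<n l))

-- Mixed-radix code of the pair: the leaf number, and the distance from i to the path neighbour of the centre.
code : (k p : ℕ) → Fin (k + p) × Fin (k + p) → ℕ
code k p (i , l) = (toℕ l ∸ k) + (k ∸ 2 ∸ toℕ i) * p

module _ {k p : ℕ} {i l : Fin (k + p)} (co : Coordinates k p i l) where
  open Coordinates co

  code≡ : code k p (i , l) ≡ r + w * p
  code≡ = cong₂ (λ u v → u + v * p)
    (trans (cong (_∸ k) l≡) (ℕ.m+n∸m≡n k r))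
    (trans (cong (λ z → z ∸ 2 ∸ toℕ i) k≡) (ℕ.m+n∸n≡m w (toℕ i)))

  -- As r < p, the code r + w p stays below (w + 1) p, which is p y.
  code<2k : code k p (i , l) < 2 * k
  code<2k = ℕ.<-≤-trans (subst (_< suc w * p) (sym code≡) (ℕ.+-monoˡ-< (w * p) r<p)) bound

mixedRadix-injective : ∀ p {r w r′ w′} → r < p → r′ < p → r + w * p ≡ r′ + w′ * p → r ≡ r′ × w ≡ w′
mixedRadix-injective p@(suc _) {r} {w} {r′} {w′} r<p r′<p eq =
  r≡r′ , ℕ.*-cancelʳ-≡ w w′ p (ℕ.+-cancelˡ-≡ r′ (w * p) (w′ * p) (trans (cong (_+ w * p) (sym r≡r′)) eq))
  where
  r≡r′ : r ≡ r′
  r≡r′ = begin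
    r                     ≡⟨ m<n⇒m%n≡m r<p ⟨
    r % p                 ≡⟨ [m+kn]%n≡m%n r w p ⟨
    (r + w * p) % p       ≡⟨ cong (_% p) eq ⟩
    (r′ + w′ * p) % p     ≡⟨ [m+kn]%n≡m%n r′ w′ p ⟩
    r′ % p                ≡⟨ m<n⇒m%n≡m r′<p ⟩
    r′                    ∎

code-injective : ∀ {k p e e′} → Coordinates k p (proj₁ e) (proj₂ e) → Coordinates k p (proj₁ e′) (proj₂ e′) →
  code k p e ≡ code k p e′ → e ≡ e′
code-injective {k} {p} {i , l} {i′ , l′} co co′ eq =
  cong₂ _,_ (toℕ-injective i≡i′) (toℕ-injective (trans (l≡ co) (trans (cong (k +_) (proj₁ same)) (sym (l≡ co′)))))
  where
  open Coordinates
  same = mixedRadix-injective p (r<p co) (r<p co′) (trans (sym (code≡ co)) (trans eq (code≡ co′)))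
  i≡i′ : toℕ i ≡ toℕ i′
  i≡i′ = ℕ.+-cancelˡ-≡ (suc (suc (w co))) (toℕ i) (toℕ i′)
    (trans (sym (k≡ co)) (trans (k≡ co′) (cong (λ z → suc (suc z + toℕ i′)) (sym (proj₂ same)))))

B₂≤2k : ∀ {k p} → 2 ≤ p → p ≤ k → B₂≤ k p (2 * k)
B₂≤2k {k} {p} 2≤p p≤k = length-≤ (code k p) (2 * k)
  (λ b → code<2k (coordinates 2≤p p≤k b))
  (λ b b′ → code-injective (coordinates 2≤p p≤k b) (coordinates 2≤p p≤k b′))

theorem5p15 : (k p : ℕ → ℕ) →
    (∀ n → 5 ≤ n → (3 ≤ k n) × (2 ≤ p n) × (k n + p n ≡ n)) →
    (∀ (ε : ℚ) → 0ℚ <ℚ ε → ∃[ N ] (∀ n → N ≤ n → ℕ→ℚ (p n) ≤ℚ ε *ℚ ℕ→ℚ (k n))) →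
    ∃[ C ] ∃[ N ] (∀ n → N ≤ n → B₂≤ (k n) (p n) (C * k n))
theorem5p15 k p shape p/k→0 with N , p≤k ← p/k→0 1ℚ (ℚ.positive⁻¹ 1ℚ) =
  -- The limit with ε = 1 gives p ≤ k from N on; adding 5 also reaches the range where `shape`
  -- applies.
  2 , 5 + N , λ n 5+N≤n → B₂≤2k (proj₁ (proj₂ (shape n (ℕ.≤-trans (ℕ.m≤m+n 5 N) 5+N≤n))))
    (ℕ→ℚ-cancel-≤ (subst (ℕ→ℚ (p n) ≤ℚ_) (ℚ.*-identityˡ (ℕ→ℚ (k n))) (p≤k n (ℕ.≤-trans (ℕ.m≤n+m N 5) 5+N≤n))))
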